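{- Let $n,m,\delta$ be integers with $\delta \geq n$ and $\delta \geq (m+1)/2$. If a hypergraph $\mathcal{H}$ with $n$ vertices, $m$ edges and minimum degree at least $\delta$ has no hamiltonian Berge cycle, then its incidence graph $I(\mathcal{H})$ is isomorphic either to $G_1(n)$ or to $G_2(a,b)$ for some positive integers $a \geq b$ with $a+b = n$ (graphs defined in the context, with parameter $\delta$).
   Context: A hypergraph $\mathcal{H}$ consists of a vertex set $V(\mathcal{H})$ and an edge set $E(\mathcal{H})$ whose elements are subsets of $V(\mathcal{H})$. The degree of a vertex is the number of edges containing it. A Berge cycle of length $\ell$ consists of $\ell$ distinct vertices $v_1,\dots,v_\ell$ and $\ell$ distinct edges $e_1,\dots,e_\ell$ with $v_i,v_{i+1}\in e_i$ (indices mod $\ell$); it is hamiltonian if $\{v_1,\dots,v_\ell\} = V(\mathcal{H})$. The incidence graph $I(\mathcal{H})$ is the bipartite graph with parts $X=V(\mathcal{H})$, $Y=E(\mathcal{H})$, with $v\in X$ adjacent to $e \in Y$ iff $v\in e$. $G_1(n)$ (when $\delta=n$): a copy of $K_{\delta,\delta-1}$ with parts $X$ of size $\delta$ and $Y_0$ of size $\delta-1$, where every vertex of $X$ receives an additional private neighbor of degree 1. $G_2(a,b)$: take a copy $H_1$ of $K_{a,\delta}$ and a copy $H_2$ of $K_{b,\delta}$ and identify one vertex of $H_1$ in its part of size $\delta$ with one vertex of $H_2$ in its part of size $\delta$; $X$ is the union of the parts of sizes $a$ and $b$. -}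

module Defs where

open import Data.Empty using (⊥)
open import Data.Fin using (Fin; toℕ)
open import Data.Fin.Subset using (Subset; _∈_)
open import Data.Fin.Subset.Properties using (_∈?_)
open import Data.List using (allFin; filter; length)
open import Data.Nat using (ℕ; suc; pred; _≤_)
open import Data.Nat.DivMod using (_mod_)
open import Data.Product using (∃)
open import Data.Sum using (_⊎_; inj₁; inj₂)
open import Data.Unit using (⊤)
open import Function.Bundles using (_↔_; _⇔_; module Inverse)
open import Function.Definitions using (Injective; StrictlySurjective)
open import Relation.Binary.PropositionalEquality using (_≡_)

-- The edges form an indexed family of vertex subsets, so repeated edges are
-- allowed, as are empty and one-element edges.  Repetition is needed for G₁
-- and G₂ below to be incidence graphs in general: each has several vertices
-- in Y with the same neighbourhood.
record Hypergraph (n m : ℕ) : Set where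
  field
    edge : Fin m → Subset n

open Hypergraph public

degree : ∀ {n m} → Hypergraph n m → Fin n → ℕ
degree {m = m} H v = length (filter (λ e → v ∈? edge H e) (allFin m))

MinDegreeAtLeast : ∀ {n m} → ℕ → Hypergraph n m → Set
MinDegreeAtLeast δ H = ∀ v → δ ≤ degree H v

next : ∀ {ℓ} → Fin ℓ → Fin ℓ
next {suc k} i = suc (toℕ i) mod suc k

-- No lower bound is put on ℓ.  A hamiltonian cycle has ℓ = n, so this only
-- concerns n ≤ 1: a vertex together with an edge containing it is a cycle of
-- length 1, and the empty cycle is hamiltonian when there are no vertices.
record BergeCycle {n m : ℕ} (H : Hypergraph n m) (ℓ : ℕ) : Set where
  field
    vertexAt           : Fin ℓ → Fin n
    edgeAt             : Fin ℓ → Fin m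
    vertexAt-injective : Injective _≡_ _≡_ vertexAt
    edgeAt-injective   : Injective _≡_ _≡_ edgeAt
    v∈e                : ∀ i → vertexAt i ∈ edge H (edgeAt i)
    next-v∈e           : ∀ i → vertexAt (next i) ∈ edge H (edgeAt i)

Hamiltonian : ∀ {n m ℓ} {H : Hypergraph n m} → BergeCycle H ℓ → Set
Hamiltonian C = StrictlySurjective _≡_ (BergeCycle.vertexAt C)

HasHamiltonianBergeCycle : ∀ {n m} → Hypergraph n m → Set
HasHamiltonianBergeCycle H = ∃ λ ℓ → ∃ λ (C : BergeCycle H ℓ) → Hamiltonian C

-- A bipartite graph with an ordered pair of designated parts.
record Bigraph : Set₁ where
  field
    X   : Set
    Y   : Set
    Adj : X → Y → Set

-- Isomorphisms carry X to X and Y to Y.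
record _≅_ (G K : Bigraph) : Set where
  private
    module G = Bigraph G
    module K = Bigraph K
  field
    X-iso   : G.X ↔ K.X
    Y-iso   : G.Y ↔ K.Y
    Adj-iso : ∀ x y → G.Adj x y ⇔ K.Adj (Inverse.to X-iso x) (Inverse.to Y-iso y)

infix 4 _≅_

incidenceGraph : ∀ {n m} → Hypergraph n m → Bigraph
incidenceGraph {n} {m} H = record
  { X   = Fin n
  ; Y   = Fin m
  ; Adj = λ v e → v ∈ edge H e
  }

-- Only used when δ = n, so that X has size δ and Y₀ has size δ − 1.
-- In Y, inj₁ is Y₀ and inj₂ x is the private neighbour of x.
G₁ : ℕ → Bigraph
G₁ n = record { X = Fin n ; Y = Fin (pred n) ⊎ Fin n ; Adj = adj }
  where
  adj : Fin n → Fin (pred n) ⊎ Fin n → Set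
  adj x (inj₁ _) = ⊤
  adj x (inj₂ p) = x ≡ p

-- The two parts of size δ after identifying one vertex of each.
-- Meaningful for δ ≥ 1.
data Glued (δ : ℕ) : Set where
  shared : Glued δ
  left   : Fin (pred δ) → Glued δ
  right  : Fin (pred δ) → Glued δ

G₂ : (δ a b : ℕ) → Bigraph
G₂ δ a b = record { X = Fin a ⊎ Fin b ; Y = Glued δ ; Adj = adj }
  where
  adj : Fin a ⊎ Fin b → Glued δ → Set
  adj _        shared    = ⊤
  adj (inj₁ _) (left _)  = ⊤
  adj (inj₁ _) (right _) = ⊥
  adj (inj₂ _) (left _)  = ⊥
  adj (inj₂ _) (right _) = ⊤

{-# OPTIONS --safe #-}
module Submission where

-- Vertices are added one at a time: for a list vs of at most δ vertices, either vs is covered by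
-- a hamiltonian cycle, or the incidence graph restricted to vs looks like G₁ or G₂.  As δ is fixed
-- and exceeds the number of earlier vertices, only a hamiltonian cycle or G₂ has to be extended.
--
-- Let x be a new vertex and C a hamiltonian cycle on the k < δ earlier ones, with vertices xᵢ and
-- edges yᵢ joining xᵢ to xᵢ₊₁.  Call (xᵢ , yᵢ , xᵢ₊₁) a chord if x lies on yᵢ, and let D be the
-- number of chords.
-- * D = 0: any two vertices share an edge because 2δ > m.  If x cannot be inserted, all xᵢ share
--   with x the same single edge, which gives G₂ with one block {x}.
-- * D ≥ 1: if there is no longer cycle, the edges off C at x and at the xᵢ that begin chords are
--   pairwise disjoint sets.  Double counting then forces all inequalities to be equalities: chord
--   vertices lie on all edges of C, every edge off C meets exactly one of x and the chord
--   vertices, and δ = k + 1 if D ≥ 2.  Hence no vertex of C shares with x an edge off C.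
--   D = 1 gives G₂, D = k gives G₁, and 1 < D < k gives a cycle through x after all.
--
-- No case distinction on the existence of a hamiltonian cycle is available constructively;
-- instead every exclusion is a finite search that either returns a cycle or succeeds.

open import Defs
import Algebra.Solver.CommutativeMonoid as CommutativeMonoidSolver
open import Data.Fin using (Fin; zero; suc; toℕ; inject≤)
import Data.Fin.Properties as Fin
open import Data.Fin.Subset using () renaming (_∈_ to _∈ₛ_)
open import Data.Fin.Subset.Properties using () renaming (_∈?_ to _∈ₛ?_)
open import Data.List using (List; []; _∷_; _++_; [_]; _∷ʳ_; map; length; filter; allFin; lookup)
open import Data.List.Properties using
  (map-++; map-cong; map-id; length-map; length-++; length-tabulate; length-filter;
   filter-none; filter-complete; ++-assoc)
open import Data.List.Membership.Propositional using (_∈_; _∉_; find; lose)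
open import Data.List.Membership.Propositional.Properties using
  (∈-∃++; ∈-allFin; ∈-filter⁺; ∈-filter⁻; ∈-map⁺; ∈-map⁻; ∈-++⁻; ∈-lookup)
open import Data.List.Relation.Unary.All as All using (All; []; _∷_)
import Data.List.Relation.Unary.All.Properties as All
open import Data.List.Relation.Unary.AllPairs using (AllPairs; []; _∷_)
import Data.List.Relation.Unary.AllPairs.Properties as AllPairs
open import Data.List.Relation.Unary.Any as Any using (here; there)
open import Data.List.Relation.Unary.Any.Properties using (lookup-index)
open import Data.List.Relation.Unary.Unique.Propositional using (Unique)
import Data.List.Relation.Unary.Unique.Propositional.Properties as Unique
open import Data.List.Relation.Binary.Disjoint.Propositional using (Disjoint)
open import Data.List.Relation.Binary.Permutation.Propositional using
  (_↭_; ↭-refl; ↭-sym; ↭-trans; ↭-prep; ↭-swap; ↭-reflexive; ↭⇒↭ₛ)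
open import Data.List.Relation.Binary.Permutation.Propositional.Properties using
  (shift; ++-comm; ++⁺; ∈-resp-↭; ++-commutativeMonoid; ↭-length; map⁺; filter-↭; drop-∷)
import Data.List.Relation.Binary.Permutation.Setoid.Properties as Permutationₛ
open import Data.Nat using (ℕ; zero; suc; pred; _+_; _*_; _≤_; _<_; _≥_; z≤n; s≤s)
open import Data.Nat.DivMod using (_%_; m<n⇒m%n≡m; n%n≡0)
open import Data.Nat.ListAction using (sum)
open import Data.Nat.ListAction.Properties using (sum-++; sum-↭)
open import Data.Nat.Properties
open import Data.Nat.Solver using (module +-*-Solver)
open import Data.Product using (∃; ∃-syntax; _×_; _,_; proj₁; proj₂; swap)
open import Data.Sum using (_⊎_; inj₁; inj₂)
open import Data.Unit using (tt)
open import Function using (_∘_; case_of_)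
open import Function.Bundles using (_↔_; mk↔ₛ′; _⇔_; mk⇔; module Inverse)
open import Function.Construct.Identity using (↔-id)
open import Function.Construct.Symmetry using (↔-sym)
open import Function.Definitions using (Injective)
open import Relation.Binary.PropositionalEquality using
  (_≡_; _≢_; refl; sym; trans; cong; cong₂; subst; setoid)
open import Relation.Nullary using (¬_; Dec; yes; no; ¬?; contradiction; _×-dec_)

-- Duplicate-free lists up to permutation

module _ {A : Set} where

  open Permutationₛ (setoid A) using (Unique-resp-↭)

  unique-↭ : {xs ys : List A} → xs ↭ ys → Unique xs → Unique ys
  unique-↭ p = Unique-resp-↭ (↭⇒↭ₛ p)

  unique-∷ : {x : A} {xs : List A} → x ∉ xs → Unique xs → Unique (x ∷ xs)
  unique-∷ x∉xs u = All.¬Any⇒All¬ _ x∉xs ∷ u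

  -- The entries of `xs` are taken out of `ys` one at a time; as `xs` has no repetitions, an entry
  -- still to be taken out is never the one just removed.
  ↭-complement : {xs ys : List A} → Unique xs → (∀ {x} → x ∈ xs → x ∈ ys) →
                 ∃ λ zs → ys ↭ xs ++ zs
  ↭-complement {[]} {ys} _ _ = ys , ↭-refl
  ↭-complement {x ∷ xs} (x∉ ∷ u) xs⊆ys with ∈-∃++ (xs⊆ys (here refl))
  ... | as , bs , refl = _ , ↭-trans (shift x as bs) (↭-prep x (proj₂ rest))
    where
    remaining : ∀ {y} → y ∈ xs → y ∈ as ++ bs
    remaining y∈ with ∈-resp-↭ (shift x as bs) (xs⊆ys (there y∈))
    ... | here refl = contradiction y∈ (All.All¬⇒¬Any x∉)
    ... | there y∈′ = y∈′
    rest = ↭-complement u remaining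

  ∈-↭-∷ : {x : A} {xs : List A} → x ∈ xs → ∃ λ ys → xs ↭ x ∷ ys
  ∈-↭-∷ x∈xs with ∈-∃++ x∈xs
  ... | as , bs , refl = as ++ bs , shift _ as bs

  unique-++⁻ : ∀ xs {ys : List A} → Unique (xs ++ ys) → Unique xs × Unique ys × Disjoint xs ys
  unique-++⁻ [] u = [] , u , λ ()
  unique-++⁻ (x ∷ xs) (n ∷ u) with unique-++⁻ xs u
  ... | uxs , uys , dis = All.++⁻ˡ xs n ∷ uxs , uys , λ
    { (here refl , j) → All.lookup (All.++⁻ʳ xs n) j refl
    ; (there i , j)   → dis (i , j) }

-- Walks

-- A list ((x₁ , y₁) ∷ … ∷ (xₗ , yₗ) ∷ []) is a walk from x₁ to b when each
-- yᵢ joins xᵢ to xᵢ₊₁, where xₗ₊₁ is b; so b itself is not listed.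
data Walk {X Y : Set} (S : X → Y → X → Set) : X → List (X × Y) → X → Set where
  []  : ∀ {a} → Walk S a [] a
  _∷_ : ∀ {a y b c z} → S a y b → Walk S b c z → Walk S a ((a , y) ∷ c) z

module _ {X Y : Set} {S : X → Y → X → Set} where

  infixr 5 _++ʷ_

  _++ʷ_ : ∀ {a b z c d} → Walk S a c b → Walk S b d z → Walk S a (c ++ d) z
  []      ++ʷ v = v
  (s ∷ w) ++ʷ v = s ∷ (w ++ʷ v)

  split : ∀ {a b p c} → Walk S a c b → p ∈ c →
          ∃[ d ] ∃[ q ] ∃[ e ] (c ≡ d ++ p ∷ e × Walk S a d (proj₁ p)
                                × S (proj₁ p) (proj₂ p) q × Walk S q e b)
  split (s ∷ w) (here refl) = [] , _ , _ , refl , [] , s , w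
  split (s ∷ w) (there i) with split w i
  ... | d , q , e , refl , v , t , v′ = _ ∷ d , q , e , refl , s ∷ v , t , v′

  open-at : ∀ {a p c} → Walk S a c a → p ∈ c →
            ∃[ q ] ∃[ d ] (S (proj₁ p) (proj₂ p) q × Walk S q d (proj₁ p) × c ↭ p ∷ d)
  open-at w i with split w i
  ... | d , q , e , refl , v , s , v′ =
    q , e ++ d , s , v′ ++ʷ v , ↭-trans (shift _ d e) (↭-prep _ (++-comm d e))

  -- A closed walk can be opened at each of its steps, so `f` sees a step together with the rest of
  -- the cycle. In `go`, `u` is the part already passed, which makes `v ++ʷ u` the cycle without the
  -- current step.
  refine : ∀ {P : Set} {T : X → Y → X → Set} {a c} → Walk S a c a →
           (∀ {z y q d} → S z y q → Walk S q d z → c ↭ (z , y) ∷ d → P ⊎ T z y q) →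
           P ⊎ Walk T a c a
  refine {P} {T} {a} {c} w f = go [] w ↭-refl
    where
    go : ∀ {b d e} → Walk S a d b → Walk S b e a → c ↭ d ++ e → P ⊎ Walk T b e a
    go u [] p = inj₂ []
    go {b} {d} u (_∷_ {y = y} {b = q} {c = e} s v) p
      with f s (v ++ʷ u) (↭-trans p (↭-trans (shift _ d e) (↭-prep _ (++-comm d e))))
         | go (u ++ʷ (s ∷ [])) v (↭-trans p (↭-reflexive (sym (++-assoc d [ b , y ] e))))
    ... | inj₁ h | _      = inj₁ h
    ... | inj₂ _ | inj₁ h = inj₁ h
    ... | inj₂ t | inj₂ r = inj₂ (t ∷ r)

  strengthen : ∀ {T : X → Y → X → Set} {a b c} → Walk S a c b →
               (∀ {z y q} → (z , y) ∈ c → S z y q → T z y q) → Walk T a c b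
  strengthen []      f = []
  strengthen (s ∷ w) f = f (here refl) s ∷ strengthen w (f ∘ there)

module _ {X Y : Set} {S : X → Y → X → Set} where

  -- A step pairs an edge with the vertex before it, so reversal pairs the edge with its other end
  -- instead. The vertex lists agree only once the final vertex of each walk is added.
  reverseʷ : ∀ {a b c} → Walk S a c b →
             ∃[ d ] (Walk (λ q y z → S z y q) b d a
                     × map proj₁ d ∷ʳ a ↭ map proj₁ c ∷ʳ b × map proj₂ d ↭ map proj₂ c)
  reverseʷ [] = [] , [] , ↭-refl , ↭-refl
  reverseʷ {a} (_∷_ {y = y} {b = q} s w) with reverseʷ w
  ... | d , v , p₁ , p₂ = d ++ [ q , y ] , v ++ʷ (s ∷ [])
    , ↭-trans (++-comm _ [ a ]) (↭-prep a (↭-trans (↭-reflexive (map-++ proj₁ d _)) p₁))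
    , ↭-trans (↭-reflexive (map-++ proj₂ d _)) (↭-trans (++-comm _ [ y ]) (↭-prep y p₂))

module ↭-Solver {A : Set} = CommutativeMonoidSolver (++-commutativeMonoid {A = A})

-- Paths and hamiltonian cycles

module Paths {X Y : Set} (_~_ : X → Y → Set) where

  Link : X → Y → X → Set
  Link a y b = a ~ y × b ~ y

  -- Unlike a walk, a path counts its last vertex. Vertices and edges are kept up to permutation,
  -- and distinctness of edges is demanded only in `close`, so arcs can be reversed and joined
  -- freely.
  record Path (a b : X) (vs : List X) (ys : List Y) : Set where
    constructor path
    field
      {steps}  : List (X × Y)
      walk     : Walk Link a steps b
      vertices : map proj₁ steps ∷ʳ b ↭ vs
      edges    : map proj₂ steps ↭ ys

  point : ∀ a → Path a a [ a ] []
  point a = path [] ↭-refl ↭-refl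

  ofWalk : ∀ {a b c} → Walk Link a c b → Path a b (map proj₁ c ∷ʳ b) (map proj₂ c)
  ofWalk w = path w ↭-refl ↭-refl

  link : ∀ {a b c d vs us ys zs} y → Path a b vs ys → b ~ y → c ~ y → Path c d us zs →
         Path a d (vs ++ us) (ys ++ y ∷ zs)
  link {b = b} {d = d} y (path {cs} w p q) r s (path {ds} w′ p′ q′) =
    path (w ++ʷ ((r , s) ∷ w′))
      (↭-trans (↭-reflexive eq) (++⁺ p p′))
      (↭-trans (↭-reflexive (map-++ proj₂ cs _)) (++⁺ q (↭-prep y q′)))
    where
    eq : map proj₁ (cs ++ (b , y) ∷ ds) ∷ʳ d ≡ (map proj₁ cs ∷ʳ b) ++ (map proj₁ ds ∷ʳ d)
    eq = trans (cong (_∷ʳ d) (map-++ proj₁ cs _))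
          (trans (++-assoc (map proj₁ cs) _ _) (sym (++-assoc (map proj₁ cs) [ b ] _)))

  rev : ∀ {a b vs ys} → Path a b vs ys → Path b a vs ys
  rev (path w p q) with reverseʷ w
  ... | _ , v , p′ , q′ = path (strengthen v λ _ → swap) (↭-trans p′ p) (↭-trans q′ q)

  -- Distinctness of the vertices is inherited from `vs`. For a single vertex the walk is one step
  -- from it to itself.
  record Ham (vs : List X) : Set where
    constructor ham
    field
      {base}   : X
      {steps}  : List (X × Y)
      walk     : Walk Link base steps base
      vertices : map proj₁ steps ↭ vs
      unique   : Unique (map proj₂ steps)

  close : ∀ {a b vs us ys zs} y → Path a b vs ys → b ~ y → a ~ y →
          vs ↭ us → y ∷ ys ↭ zs → Unique zs → Ham us
  close {b = b} y (path {cs} w p q) r s pv pe u =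
    ham (w ++ʷ ((r , s) ∷ []))
      (↭-trans (↭-reflexive (map-++ proj₁ cs _)) (↭-trans p pv))
      (unique-↭ (↭-sym (↭-trans (↭-reflexive (map-++ proj₂ cs _))
        (↭-trans (++-comm (map proj₂ cs) _) (↭-trans (↭-prep y q) pe)))) u)

-- Counting incidences

module _ {A : Set} where

  sum-mono : ∀ {f g : A → ℕ} {xs} → All (λ x → f x ≤ g x) xs → sum (map f xs) ≤ sum (map g xs)
  sum-mono []       = z≤n
  sum-mono (p ∷ ps) = +-mono-≤ p (sum-mono ps)

  -- A strict inequality at one entry could not be made up elsewhere. This turns equality of total
  -- counts into equality at each edge.
  sum-tight : ∀ {f g : A → ℕ} {xs} → All (λ x → f x ≤ g x) xs →
              sum (map g xs) ≤ sum (map f xs) → All (λ x → f x ≡ g x) xs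
  sum-tight [] _ = []
  sum-tight {f} {g} {x ∷ xs} (p ∷ ps) le =
    ≤-antisym p (+-cancelʳ-≤ _ _ _ (≤-trans le (+-monoʳ-≤ (f x) (sum-mono ps)))) ∷
    sum-tight ps (+-cancelˡ-≤ (g x) _ _ (≤-trans le (+-monoˡ-≤ _ p)))

  sum-const : ∀ c (xs : List A) → sum (map (λ _ → c) xs) ≡ length xs * c
  sum-const c []       = refl
  sum-const c (_ ∷ xs) = cong (c +_) (sum-const c xs)

  sum-+ : ∀ (f g : A → ℕ) xs → sum (map (λ x → f x + g x) xs) ≡ sum (map f xs) + sum (map g xs)
  sum-+ f g []       = refl
  sum-+ f g (x ∷ xs) = trans (cong (f x + g x +_) (sum-+ f g xs))
    (solve 4 (λ a b c d → (a :+ b) :+ (c :+ d) := (a :+ c) :+ (b :+ d)) refl (f x) (g x) _ _)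
    where open +-*-Solver

  filter-full : ∀ {P : A → Set} (P? : ∀ x → Dec (P x)) xs →
                length (filter P? xs) ≡ length xs → All P xs
  filter-full P? xs eq = subst (All _) (filter-complete P? eq) (All.all-filter P? xs)

  filter-map : ∀ {B : Set} {P : B → Set} (P? : ∀ x → Dec (P x)) (f : A → B) xs →
               filter P? (map f xs) ≡ map f (filter (P? ∘ f) xs)
  filter-map P? f [] = refl
  filter-map P? f (x ∷ xs) with P? (f x)
  ... | yes _ = cong (f x ∷_) (filter-map P? f xs)
  ... | no  _ = filter-map P? f xs

module _ {A : Set} {P : Set} {Q : A → Set} where

  find-or-all : ∀ xs → (∀ {x} → x ∈ xs → P ⊎ Q x) → P ⊎ (∀ {x} → x ∈ xs → Q x)
  find-or-all [] f = inj₂ λ ()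
  find-or-all (x ∷ xs) f with f (here refl) | find-or-all xs (f ∘ there)
  ... | inj₁ p | _      = inj₁ p
  ... | inj₂ _ | inj₁ p = inj₁ p
  ... | inj₂ q | inj₂ g = inj₂ λ { (here refl) → q ; (there i) → g i }

-- Used with the edge of a step as `f`: chords are told apart by their edges, which are distinct
-- along the cycle.
allPairs-of-map : {A B : Set} (f : A → B) {R : A → A → Set} {xs : List A} → Unique (map f xs) →
                  (∀ {a b} → a ∈ xs → b ∈ xs → f a ≢ f b → R a b) → AllPairs R xs
allPairs-of-map f {xs = []} _ _ = []
allPairs-of-map f {xs = x ∷ xs} (n ∷ u) r =
  All.tabulate (λ i → r (here refl) (there i) (All.lookup n (∈-map⁺ f i))) ∷
  allPairs-of-map f u λ i j → r (there i) (there j)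

unique-map-injective : {A B : Set} (f : A → B) {xs : List A} → Unique (map f xs) →
                       ∀ {a b} → a ∈ xs → b ∈ xs → f a ≡ f b → a ≡ b
unique-map-injective f _       (here refl) (here refl) _ = refl
unique-map-injective f (n ∷ _) (here refl) (there j) e = contradiction e (All.lookup n (∈-map⁺ f j))
unique-map-injective f (n ∷ _) (there i) (here refl) e = contradiction (sym e) (All.lookup n (∈-map⁺ f i))
unique-map-injective f (_ ∷ u) (there i) (there j) e = unique-map-injective f u i j e

module Counting {m : ℕ} {X : Set} (_~_ : X → Fin m → Set) (_~?_ : ∀ x y → Dec (x ~ y)) where

  open Paths _~_ public

  degreeIn : List (Fin m) → X → ℕ
  degreeIn ys x = length (filter (x ~?_) ys)

  hits : List X → Fin m → ℕ
  hits L y = length (filter (_~? y) L)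

  hits-∷ : ∀ x L y → hits (x ∷ L) y ≡ hits [ x ] y + hits L y
  hits-∷ x L y with x ~? y
  ... | yes _ = refl
  ... | no  _ = refl

  sum-hits-[-] : ∀ x ys → sum (map (hits [ x ]) ys) ≡ degreeIn ys x
  sum-hits-[-] x [] = refl
  sum-hits-[-] x (y ∷ ys) with x ~? y
  ... | yes _ = cong suc (sum-hits-[-] x ys)
  ... | no  _ = sum-hits-[-] x ys

  double-count : ∀ L ys → sum (map (degreeIn ys) L) ≡ sum (map (hits L) ys)
  double-count [] ys = sym (trans (sum-const 0 ys) (*-zeroʳ (length ys)))
  double-count (x ∷ L) ys =
    trans (cong₂ _+_ (sym (sum-hits-[-] x ys)) (double-count L ys))
      (trans (sym (sum-+ (hits [ x ]) (hits L) ys))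
        (cong sum (map-cong (λ y → sym (hits-∷ x L y)) ys)))

  hits≤1 : ∀ {y L} → AllPairs (λ a b → ¬ (a ~ y × b ~ y)) L → hits L y ≤ 1
  hits≤1 [] = z≤n
  hits≤1 {y} {a ∷ L} (n ∷ ns) with a ~? y
  ... | yes a~y rewrite filter-none (_~? y) (All.map (λ f b~y → f (a~y , b~y)) n) = ≤-refl
  ... | no  _   = hits≤1 ns

  hit : ∀ {y} L → 0 < hits L y → ∃ λ z → z ∈ L × z ~ y
  hit {y} L pos with filter (_~? y) L in eq
  ... | z ∷ _ = z , ∈-filter⁻ (_~? y) {xs = L} (subst (z ∈_) (sym eq) (here refl))

module _ {m : ℕ} where
  open import Data.List.Membership.DecPropositional (Fin._≟_ {m}) public using (_∈?_)

-- Consequences of minimum degree δ with m < 2δ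

module MinDegree {m : ℕ} {X : Set} (_~_ : X → Fin m → Set) (_~?_ : ∀ x y → Dec (x ~ y))
  {δ : ℕ} (δ≤degree : ∀ x → δ ≤ Counting.degreeIn _~_ _~?_ (allFin m) x) (m<2δ : m < 2 * δ) where

  open Counting _~_ _~?_

  degree-bound : ∀ L ys {zs} → allFin m ↭ ys ++ zs →
                 length L * δ ≤ sum (map (hits L) ys) + sum (map (hits L) zs)
  degree-bound L ys {zs} p = begin
    length L * δ                                      ≡⟨ sum-const δ L ⟨
    sum (map (λ _ → δ) L)                             ≤⟨ sum-mono (All.universal δ≤degree L) ⟩
    sum (map (degreeIn (allFin m)) L)                 ≡⟨ double-count L (allFin m) ⟩
    sum (map (hits L) (allFin m))                     ≡⟨ sum-↭ (map⁺ (hits L) p) ⟩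
    sum (map (hits L) (ys ++ zs))                     ≡⟨ cong sum (map-++ (hits L) ys zs) ⟩
    sum (map (hits L) ys ++ map (hits L) zs)          ≡⟨ sum-++ (map (hits L) ys) _ ⟩
    sum (map (hits L) ys) + sum (map (hits L) zs)     ∎
    where open ≤-Reasoning

  module _ L {ys zs} (p : allFin m ↭ ys ++ zs) {g : Fin m → ℕ}
    (on-ys : All (λ y → hits L y ≤ g y) ys) (on-zs : All (λ y → hits L y ≤ 1) zs) where

    degree-bound′ : length L * δ ≤ sum (map g ys) + length zs
    degree-bound′ = ≤-trans (degree-bound L ys p) (+-mono-≤ (sum-mono on-ys)
      (≤-trans (sum-mono on-zs) (≤-reflexive (trans (sum-const 1 zs) (*-identityʳ _)))))

    -- The degrees force at least `length L * δ` incidences, so neither `ys` nor `zs` can fall short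
    -- of its upper bound, and then no single edge can.
    degree-tight : sum (map g ys) + length zs ≤ length L * δ →
                   All (λ y → hits L y ≡ g y) ys × All (λ y → hits L y ≡ 1) zs
    degree-tight le =
      sum-tight on-ys (+-cancelʳ-≤ (length zs) _ _ (≤-trans le
        (≤-trans (degree-bound L ys p) (+-monoʳ-≤ _ zs≤)))) ,
      sum-tight on-zs (≤-trans (≤-reflexive one) (+-cancelˡ-≤ _ _ _ (≤-trans le
        (≤-trans (degree-bound L ys p) (+-monoˡ-≤ _ (sum-mono on-ys))))))
      where
      one = trans (sum-const 1 zs) (*-identityʳ (length zs))
      zs≤ = ≤-trans (sum-mono on-zs) (≤-reflexive one)

  -- Otherwise every edge would meet at most one of `p` and `q`, giving 2δ ≤ m. For `p` = `q` this
  -- yields an edge at `p`.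
  common-neighbour : ∀ p q → ∃ λ y → p ~ y × q ~ y
  common-neighbour p q with Fin.any? (λ y → (p ~? y) ×-dec (q ~? y))
  ... | yes found = found
  ... | no none = contradiction
    (≤-trans (degree-bound′ (p ∷ q ∷ []) {[]} ↭-refl {λ _ → 0} []
        (All.universal (λ y → hits≤1 (((λ r → none (y , r)) ∷ []) ∷ [] ∷ [])) _))
      (≤-reflexive (length-tabulate _)))
    (<⇒≱ m<2δ)

  length-complement : ∀ ys {zs} → allFin m ↭ ys ++ zs → suc (length ys + length zs) ≤ 2 * δ
  length-complement ys p = ≤-trans
    (s≤s (≤-reflexive (trans (sym (length-++ ys)) (trans (sym (↭-length p)) (length-tabulate _))))) m<2δ

  -- Equality in 2δ ≤ deg p + deg q ≤ m + 1 ≤ 2δ.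
  sharing-tight : ∀ {p q s} → (∀ {y} → p ~ y → q ~ y → y ≡ s) →
                  (p ~ s × q ~ s) × (∀ y → p ~ y ⊎ q ~ y)
  sharing-tight {p} {q} {s} common with ∈-↭-∷ (∈-allFin s)
  ... | zs , perm = both , either
    where
    pq = p ∷ q ∷ []
    uniq = unique-↭ perm (Unique.allFin⁺ m)
    tight = degree-tight pq {[ s ]} {zs} perm {λ _ → 2} (length-filter (_~? s) pq ∷ [])
      (All.tabulate λ {y} y∈ → hits≤1 (((λ (a , b) →
        case common a b of λ { refl → Unique.Unique[x∷xs]⇒x∉xs uniq y∈ }) ∷ []) ∷ [] ∷ []))
      (length-complement [ s ] perm)
    both : p ~ s × q ~ s
    both with filter-full (_~? s) pq (All.head (proj₁ tight))
    ... | a ∷ b ∷ [] = a , b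
    either : ∀ y → p ~ y ⊎ q ~ y
    either y with ∈-resp-↭ perm (∈-allFin y)
    ... | here refl = inj₁ (proj₁ both)
    ... | there y∈ with hit pq (≤-reflexive (sym (All.lookup (proj₂ tight) y∈)))
    ...   | _ , here refl , r = inj₁ r
    ...   | _ , there (here refl) , r = inj₂ r

  -- The vertex has at least δ edges, too many to fit into `ys`.
  neighbour-outside : ∀ {ys} → length ys < δ → ∀ z → ∃ λ y → y ∉ ys × z ~ y
  neighbour-outside {ys} lt z with Fin.any? (λ y → ¬? (y ∈? ys) ×-dec (z ~? y))
  ... | yes found = found
  ... | no none with ↭-complement (Unique.filter⁺ (z ~?_) (Unique.allFin⁺ m)) inside
    where
    inside : ∀ {y} → y ∈ filter (z ~?_) (allFin m) → y ∈ ys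
    inside {y} y∈ with y ∈? ys
    ... | yes i = i
    ... | no ¬i = contradiction (y , ¬i , proj₂ (∈-filter⁻ (z ~?_) {xs = allFin m} y∈)) none
  ...   | _ , p = contradiction (≤-trans (δ≤degree z) (≤-trans (m≤m+n _ _)
            (≤-reflexive (sym (trans (↭-length p) (length-++ (filter (z ~?_) (allFin m)))))))) (<⇒≱ lt)

  -- Two blocks sharing a single edge

  -- Sharing at most `s` across the blocks determines the rest: by `sharing-tight`, `s` meets every
  -- vertex and the vertices of one block lie on the same edges.
  record TwoBlocks (vs : List X) : Set where
    field
      {a b}   : X
      {as bs} : List X
      s       : Fin m
      parts   : vs ↭ (a ∷ as) ++ (b ∷ bs)
      common  : ∀ {p q y} → p ∈ a ∷ as → q ∈ b ∷ bs → p ~ y → q ~ y → y ≡ s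

  flip : ∀ {vs} → TwoBlocks vs → TwoBlocks vs
  flip B = record
    { s = s
    ; parts = ↭-trans parts (++-comm (a ∷ as) (b ∷ bs))
    ; common = λ p∈ q∈ p~y q~y → common q∈ p∈ q~y p~y }
    where open TwoBlocks B

  module _ {vs} (B : TwoBlocks vs) where
    open TwoBlocks B

    block-common : ∀ {p} → p ∈ a ∷ as → p ~ s
    block-common p∈ = proj₁ (proj₁ (sharing-tight (common p∈ (here refl))))

    -- By tightness every edge meets `q` or `b`. An edge at `p` that meets `b` can only be `s`,
    -- which meets `q` as well.
    block-alike : ∀ {p q y} → p ∈ a ∷ as → q ∈ a ∷ as → p ~ y → q ~ y
    block-alike {y = y} p∈ q∈ p~y with proj₂ (sharing-tight (common q∈ (here refl))) y
    ... | inj₁ q~y = q~y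
    ... | inj₂ b~y with common p∈ (here refl) p~y b~y
    ...   | refl = block-common q∈

  greedy-path : ∀ z zs ys → Unique ys → length zs ≤ length ys →
                (∀ {p y} → p ∈ z ∷ zs → y ∈ ys → p ~ y) →
                ∃[ b ] ∃[ es ] (Path z b (z ∷ zs) es × b ∈ z ∷ zs × Unique es
                                × (∀ {y} → y ∈ es → y ∈ ys))
  greedy-path z [] ys _ _ _ = z , [] , point z , here refl , [] , λ ()
  greedy-path z (z′ ∷ zs) (y ∷ ys) (y∉ ∷ u) (s≤s le) complete
    with greedy-path z′ zs ys u le (λ p∈ y∈ → complete (there p∈) (there y∈))
  ... | b , es , P , b∈ , u′ , es⊆ys =
    b , y ∷ es , link y (point z) (complete (here refl) (here refl))
      (complete (there (here refl)) (here refl)) P , there b∈ ,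
    unique-∷ (λ y∈ → All.All¬⇒¬Any y∉ (es⊆ys y∈)) u′ ,
    λ { (here e) → here e ; (there y∈) → there (es⊆ys y∈) }

  -- Of the δ or more edges at `a`, `s` is reserved for the passage to the other block and `l` for
  -- the link to the new vertex; the remaining ones suffice for the steps inside the block.
  block-path : ∀ {a as s l} → 2 + length as ≤ δ → s ≢ l → a ~ s → a ~ l →
               (∀ {p y} → p ∈ a ∷ as → a ~ y → p ~ y) →
               ∃[ b ] ∃[ es ] (Path a b (a ∷ as) es × b ∈ a ∷ as × Unique (l ∷ es)
                               × (∀ {y} → y ∈ l ∷ es → a ~ y × y ≢ s))
  block-path {a} {as} {s} {l} le s≢l a~s a~l complete
    with ↭-complement {xs = s ∷ l ∷ []} ((s≢l ∷ []) ∷ [] ∷ [])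
           (λ { (here refl) → ∈-filter⁺ (a ~?_) (∈-allFin _) a~s
              ; (there (here refl)) → ∈-filter⁺ (a ~?_) (∈-allFin _) a~l })
  ... | zs , perm with unique-↭ perm (Unique.filter⁺ (a ~?_) (Unique.allFin⁺ m))
  ...   | s∉ ∷ l∉ ∷ u
    with greedy-path a as zs u
           (+-cancelˡ-≤ 2 _ _ (≤-trans le (≤-trans (δ≤degree a) (≤-reflexive (↭-length perm)))))
           (λ p∈ y∈ → complete p∈ (neighbour (there (there y∈))))
    where
    neighbour : ∀ {y} → y ∈ s ∷ l ∷ zs → a ~ y
    neighbour y∈ = proj₂ (∈-filter⁻ (a ~?_) {xs = allFin m} (∈-resp-↭ (↭-sym perm) y∈))
  ...     | b , es , P , b∈ , u′ , es⊆zs =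
    b , es , P , b∈ , unique-∷ (λ l∈ → All.All¬⇒¬Any l∉ (es⊆zs l∈)) u′ ,
    λ { (here refl) → a~l , λ { refl → s≢l refl }
      ; (there y∈) → proj₂ (∈-filter⁻ (a ~?_) {xs = allFin m}
                       (∈-resp-↭ (↭-sym perm) (there (there (es⊆zs y∈)))))
                   , λ { refl → All.All¬⇒¬Any s∉ (there (es⊆zs y∈)) } }

  -- The block of `a` is alike, so sharing only `s` with `a` means sharing only `s` with its whole
  -- block; hence `x` may join the block of `b`.
  absorb : ∀ {x vs} (B : TwoBlocks vs) → let open TwoBlocks B in
           (∀ {y} → x ~ y → a ~ y → y ≡ s) → TwoBlocks (x ∷ vs)
  absorb {x} B avoids = record
    { s = s
    ; parts = ↭-trans (↭-prep x parts) (↭-sym (shift x (a ∷ as) (b ∷ bs)))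
    ; common = λ { p∈ (here refl) p~y x~y → avoids x~y (block-alike B p∈ (here refl) p~y)
                 ; p∈ (there q∈) p~y q~y → common p∈ q∈ p~y q~y }
    }
    where open TwoBlocks B

  meets? : ∀ x a s → (∀ {y} → x ~ y → a ~ y → y ≡ s) ⊎ ∃ λ y → y ≢ s × x ~ y × a ~ y
  meets? x a s with Fin.any? (λ y → ¬? (y Fin.≟ s) ×-dec (x ~? y) ×-dec (a ~? y))
  ... | yes found = inj₂ found
  ... | no none = inj₁ λ {y} x~y a~y → case y Fin.≟ s of λ
    { (yes e) → e ; (no ne) → contradiction (y , ne , x~y , a~y) none }

  -- If x meets both blocks away from s, the cycle runs x –l– (block of a) –s– (block of b) –r– x.
  blocks-step : ∀ {x vs} → length vs < δ → TwoBlocks vs → Ham (x ∷ vs) ⊎ TwoBlocks (x ∷ vs)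
  blocks-step {x} {vs} lt B with meets? x a s | meets? x b s
    where open TwoBlocks B
  ... | inj₁ avoids | _ = inj₂ (absorb B avoids)
  ... | inj₂ _ | inj₁ avoids = inj₂ (absorb (flip B) avoids)
  ... | inj₂ (l , l≢s , x~l , a~l) | inj₂ (r , r≢s , x~r , b~r) = inj₁ joined
    where
    open TwoBlocks B
    size : (suc (length as) + suc (length bs)) < δ
    size = ≤-trans (s≤s (≤-reflexive (sym (trans (↭-length parts) (length-++ (a ∷ as)))))) lt
    a~s = block-common B (here refl)
    b~s = block-common (flip B) (here refl)
    completeᵃ : ∀ {p y} → p ∈ a ∷ as → a ~ y → p ~ y
    completeᵃ p∈ = block-alike B (here refl) p∈
    completeᵇ : ∀ {p y} → p ∈ b ∷ bs → b ~ y → p ~ y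
    completeᵇ p∈ = block-alike (flip B) (here refl) p∈
    joined : Ham (x ∷ vs)
    joined
      with block-path {a} {as} (≤-trans (s≤s (s≤s (m≤m+n _ _))) (≤-trans (≤-reflexive
             (cong suc (sym (+-suc (length as) (length bs))))) (≤-trans (n≤1+n _) size)))
             (l≢s ∘ sym) a~s a~l completeᵃ
         | block-path {b} {bs} (≤-trans (s≤s (m≤n+m _ (suc (length as)))) size) (r≢s ∘ sym) b~s b~r completeᵇ
    ... | a′ , es , P , a′∈ , uᵃ , nᵃ | b′ , fs , Q , b′∈ , uᵇ , nᵇ =
      close r (link l (point x) x~l a~l (link s P (completeᵃ a′∈ a~s) b~s Q))
        (completeᵇ b′∈ b~r) x~r
        (↭-prep x (↭-sym parts))
        (solve 5 (λ r l e s f → r ⊕ (l ⊕ (e ⊕ (s ⊕ f))) ⊜ s ⊕ ((l ⊕ e) ⊕ (r ⊕ f))) ↭-refl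
           [ r ] [ l ] es [ s ] fs)
        (unique-∷ s∉ (Unique.++⁺ uᵃ uᵇ λ (i , j) →
           proj₂ (nᵃ i) (common (here refl) (here refl) (proj₁ (nᵃ i)) (proj₁ (nᵇ j)))))
      where
      open ↭-Solver
      s∉ : s ∉ (l ∷ es) ++ (r ∷ fs)
      s∉ s∈ with ∈-++⁻ (l ∷ es) s∈
      ... | inj₁ i = proj₂ (nᵃ i) refl
      ... | inj₂ j = proj₂ (nᵇ j) refl

  separated : ∀ {x v vs} s → (∀ {q y} → q ∈ v ∷ vs → x ~ y → q ~ y → y ≡ s) →
              TwoBlocks (x ∷ v ∷ vs)
  separated s common = record
    { as = [] ; s = s ; parts = ↭-refl ; common = λ { (here refl) q∈ → common q∈ ; (there ()) } }

  -- The pattern of `G₁`, with `ys` as Y₀ and `spike` providing private neighbours. That there are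
  -- no further edges is left to counting: with δ = n these are already 2n - 1.
  record Spiked (vs : List X) : Set where
    field
      ys       : List (Fin m)
      size     : suc (length ys) ≡ length vs
      unique   : Unique ys
      complete : ∀ {z y} → z ∈ vs → y ∈ ys → z ~ y
      spike    : ∀ {z} → z ∈ vs → ∃ λ y → y ∉ ys × z ~ y × (∀ {z′} → z′ ∈ vs → z′ ~ y → z′ ≡ z)

  -- Adding a vertex to a hamiltonian cycle

  module Extension (x : X) {vs : List X} (k<δ : length vs < δ) {ys : List (Fin m)}
    (unique : Unique ys) (k≡ : length ys ≡ length vs) where

    Result : Set
    Result = Ham (x ∷ vs)

    -- The lists `vs` and `ys` stay fixed while the walk may be reversed or its steps strengthened,
    -- so "off the cycle" keeps the same meaning throughout.
    record Cycle (S : X → Fin m → X → Set) : Set where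
      constructor cycle
      field
        {start}  : X
        {steps}  : List (X × Fin m)
        walk     : Walk S start steps start
        vertices : map proj₁ steps ↭ vs
        edges    : map proj₂ steps ↭ ys

    unique-outside : ∀ {u} → u ∉ ys → Unique (u ∷ ys)
    unique-outside u∉ = unique-∷ u∉ unique

    outside : {B : Fin m → Set} → (∀ u → Dec (B u)) → (∀ {u} → u ∉ ys → B u → Result) →
              Result ⊎ (∀ {u} → u ∉ ys → ¬ B u)
    outside B? f with Fin.any? (λ u → ¬? (u ∈? ys) ×-dec B? u)
    ... | yes (u , u∉ , b) = inj₁ (f u∉ b)
    ... | no none = inj₂ λ u∉ b → none (_ , u∉ , b)

    module _ {c : List (X × Fin m)} (vertices : map proj₁ c ↭ vs) (edges : map proj₂ c ↭ ys) where

      open-vertices : ∀ {z y d} → c ↭ (z , y) ∷ d → map proj₁ d ∷ʳ z ↭ vs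
      open-vertices p = ↭-trans (++-comm _ [ _ ]) (↭-trans (↭-sym (map⁺ proj₁ p)) vertices)

      open-edges : ∀ {z y d} → c ↭ (z , y) ∷ d → y ∷ map proj₂ d ↭ ys
      open-edges p = ↭-trans (↭-sym (map⁺ proj₂ p)) edges

      cut-vertices : ∀ {z y d z′ y′ e} → c ↭ (z , y) ∷ (d ++ (z′ , y′) ∷ e) →
                     (map proj₁ d ∷ʳ z′) ++ (map proj₁ e ∷ʳ z) ↭ vs
      cut-vertices {z} {y} {d} {z′} {y′} {e} p = ↭-trans
        (solve 4 (λ z d z′ e → (d ⊕ z′) ⊕ (e ⊕ z) ⊜ (d ⊕ (z′ ⊕ e)) ⊕ z) ↭-refl
          [ z ] (map proj₁ d) [ z′ ] (map proj₁ e))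
        (↭-trans (↭-reflexive (cong (_∷ʳ z) (sym (map-++ proj₁ d _)))) (open-vertices p))
        where open ↭-Solver

      cut-edges : ∀ {z y d z′ y′ e} → c ↭ (z , y) ∷ (d ++ (z′ , y′) ∷ e) →
                  y ∷ y′ ∷ (map proj₂ d ++ map proj₂ e) ↭ ys
      cut-edges {y = y} {d} {y′ = y′} {e} p = ↭-trans
        (↭-prep y (↭-sym (↭-trans (↭-reflexive (map-++ proj₂ d _)) (shift y′ (map proj₂ d) _))))
        (open-edges p)

    -- The cycle is x -α- q ... z -β- x.
    insertion : ∀ {q z us es α β} → Path q z us es → x ~ α → q ~ α → z ~ β → x ~ β →
                us ↭ vs → Unique (α ∷ β ∷ es) → Result
    insertion {es = es} {α} {β} P x~α q~α z~β x~β pv u =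
      close β (link α (point x) x~α q~α P) z~β x~β (↭-prep x pv)
        (↭-swap β α ↭-refl) u

    -- The cycle is x -α- a ... b -β- a′ ... b′ -γ- x.
    rejoin : ∀ {a b a′ b′ us us′ es es′ α β γ fs} → Path a b us es → Path a′ b′ us′ es′ →
             x ~ α → a ~ α → b ~ β → a′ ~ β → b′ ~ γ → x ~ γ →
             us ++ us′ ↭ vs → α ∷ β ∷ γ ∷ (es ++ es′) ↭ fs → Unique fs → Result
    rejoin {es = es} {es′} {α} {β} {γ} P Q x~α a~α b~β a′~β b′~γ x~γ pv pe u =
      close γ (link α (point x) x~α a~α (link β P b~β a′~β Q)) b′~γ x~γ (↭-prep x pv)
        (↭-trans (solve 5 (λ a b c e f → c ⊕ (a ⊕ (e ⊕ (b ⊕ f))) ⊜ a ⊕ (b ⊕ (c ⊕ (e ⊕ f)))) ↭-refl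
          [ α ] [ β ] [ γ ] es es′) pe) u
      where open ↭-Solver

    -- By insertion, consecutive vertices of the cycle cannot share distinct edges with x; as
    -- each of them shares some edge with x, it is the same one all around.
    no-chord : ∀ {v vs′} → vs ≡ v ∷ vs′ → (C : Cycle Link) →
               (∀ {y} → y ∈ ys → ¬ x ~ y) → Result ⊎ TwoBlocks (x ∷ vs)
    no-chord {v} {vs′} refl (cycle {a} {c} w pv pe) none
      with refine {T = λ z y q → ∀ {u u′} → x ~ u → z ~ u → x ~ u′ → q ~ u′ → u ≡ u′} w claim
      where
      claim : ∀ {z y q d} → Link z y q → Walk Link q d z → c ↭ (z , y) ∷ d →
              Result ⊎ (∀ {u u′} → x ~ u → z ~ u → x ~ u′ → q ~ u′ → u ≡ u′)
      -- The edges `u` and `u′` meet `x`, hence lie off the cycle, and if distinct they allow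
      -- inserting `x` between `z` and `q`.
      claim {z} {y} {q} {d} _ w′ p
        with Fin.any? (λ u → Fin.any? λ u′ → (x ~? u) ×-dec (z ~? u) ×-dec (x ~? u′) ×-dec (q ~? u′)
                                               ×-dec ¬? (u Fin.≟ u′))
      ... | no ok = inj₂ λ {u} {u′} r s t o → case u Fin.≟ u′ of λ
        { (yes e) → e ; (no ne) → contradiction (u , u′ , r , s , t , o , ne) ok }
      ... | yes (u , u′ , r , s , t , o , ne) with unique-↭ (↭-sym (open-edges pv pe p)) unique
      ...   | _ ∷ ud = inj₁ (insertion (ofWalk w′) t o s r (open-vertices pv pe p)
        (unique-∷ (λ { (here e) → ne (sym e) ; (there i) → none (d⊆ i) t })
          (unique-∷ (λ i → none (d⊆ i) r) ud)))
        where
        d⊆ : ∀ {y} → y ∈ map proj₂ d → y ∈ ys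
        d⊆ i = ∈-resp-↭ (open-edges pv pe p) (there i)
    ... | inj₁ h = inj₁ h
    ... | inj₂ w′ with common-neighbour x a
    ...   | s , x~s , a~s = inj₂ (separated s λ q∈ → start w′ x~s a~s (∈-resp-↭ (↭-sym pv) q∈))
      where
      T : X → Fin m → X → Set
      T z y q = ∀ {u u′} → x ~ u → z ~ u → x ~ u′ → q ~ u′ → u ≡ u′
      -- Each vertex shares some edge with `x`, and `T` identifies it with every edge that the
      -- successor shares with `x`; so `s` is passed on.
      along : ∀ {b d z} → Walk T b d z → (∀ {u} → x ~ u → b ~ u → u ≡ s) →
              (∀ {p u} → p ∈ map proj₁ d → x ~ u → p ~ u → u ≡ s) × (∀ {u} → x ~ u → z ~ u → u ≡ s)
      along [] f = (λ ()) , f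
      along {b} (t ∷ v) f with common-neighbour x b
      ... | u , x~u , b~u with along v (λ r o → trans (sym (t x~u b~u r o)) (f x~u b~u))
      ...   | g , h = (λ { (here refl) → f ; (there i) → g i }) , h
      -- At the base it is at first only known that `s` is one shared edge; that it is the only one
      -- follows on returning there.
      start : ∀ {b d} → Walk T b d b → x ~ s → b ~ s →
              ∀ {p u} → p ∈ map proj₁ d → x ~ u → p ~ u → u ≡ s
      start (t ∷ v) x~s b~s with along v (λ r o → sym (t x~s b~s r o))
      ... | g , h = λ { (here refl) → h ; (there i) → g i }

    -- Chords and the double count

    Chord : X × Fin m → Set
    Chord p = x ~ proj₂ p

    chord? : ∀ p → Dec (Chord p)
    chord? p = x ~? proj₂ p

    -- The fields `insert-free` and `cross-free` come from excluding longer cycles; `complete`,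
    -- `covered` and `tight` are what equality in the double count then yields.
    record Chorded (c : List (X × Fin m)) : Set where
      field
        complete    : ∀ {p y} → p ∈ c → Chord p → y ∈ ys → proj₁ p ~ y
        covered     : ∀ {u} → u ∉ ys → x ~ u ⊎ ∃ λ p → p ∈ c × Chord p × proj₁ p ~ u
        insert-free : ∀ {p u} → p ∈ c → Chord p → u ∉ ys → ¬ (x ~ u × proj₁ p ~ u)
        cross-free  : ∀ {p q u} → p ∈ c → q ∈ c → Chord p → Chord q → proj₂ p ≢ proj₂ q →
                      u ∉ ys → ¬ (proj₁ p ~ u × proj₁ q ~ u)
        tight       : ∀ {p q} → p ∈ c → q ∈ c → Chord p → Chord q → proj₂ p ≢ proj₂ q →
                      δ ≡ suc (length vs)

    -- The cycle x –y– q … z –u– x, for a step (z , y , q) that is a chord.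
    chorded-insertion : (C : Cycle Link) → let open Cycle C in
      ∀ {p} → p ∈ steps → Result ⊎ (Chord p → ∀ {u} → u ∉ ys → ¬ (x ~ u × proj₁ p ~ u))
    chorded-insertion (cycle w pv pe) {p} i with chord? p
    ... | no ¬chord = inj₂ λ chord → contradiction chord ¬chord
    ... | yes chord with outside (λ u → (x ~? u) ×-dec (proj₁ p ~? u)) claim
      where
      claim : ∀ {u} → u ∉ ys → x ~ u × proj₁ p ~ u → Result
      claim u∉ (x~u , z~u) with open-at w i
      ... | q , d , (_ , q~y) , w′ , perm =
        insertion (ofWalk w′) chord q~y z~u x~u (open-vertices pv pe perm)
          (unique-↭ (↭-trans (↭-prep _ (↭-sym (open-edges pv pe perm))) (↭-swap _ _ ↭-refl))
            (unique-outside u∉))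
    ...   | inj₁ h = inj₁ h
    ...   | inj₂ f = inj₂ λ _ → f

    -- With p = (z , y) and q = (z′ , y′), and a, b their successors, the cycle is
    -- x –y– a … z′ –u– z … b –y′– x, the second arc being run backwards.
    chorded-crossing : (C : Cycle Link) → let open Cycle C in
      ∀ {p} → p ∈ steps → ∀ {q} → q ∈ steps →
      Result ⊎ (Chord p → Chord q → proj₂ p ≢ proj₂ q → ∀ {u} → u ∉ ys → ¬ (proj₁ p ~ u × proj₁ q ~ u))
    chorded-crossing (cycle w pv pe) {p} i {q} j
      with chord? p | chord? q | proj₂ p Fin.≟ proj₂ q
    ... | no ¬chord | _ | _ = inj₂ λ chord → contradiction chord ¬chord
    ... | yes _ | no ¬chord | _ = inj₂ λ _ chord → contradiction chord ¬chord
    ... | yes _ | yes _ | yes e = inj₂ λ _ _ ne → contradiction e ne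
    ... | yes chordᵖ | yes chordᵠ | no ne
      with outside (λ u → (proj₁ p ~? u) ×-dec (proj₁ q ~? u)) claim
      where
      claim : ∀ {u} → u ∉ ys → proj₁ p ~ u × proj₁ q ~ u → Result
      claim {u} u∉ (p~u , q~u) with open-at w i
      ... | _ , d , (_ , a~y) , w′ , perm with ∈-resp-↭ perm j
      ...   | here refl = contradiction refl ne
      ...   | there j′ with split w′ j′
      ...     | d₁ , _ , d₂ , refl , w₁ , (_ , b~y) , w₂ =
        rejoin (ofWalk w₁) (rev (ofWalk w₂)) chordᵖ a~y q~u p~u b~y chordᵠ
          (cut-vertices pv pe {d = d₁} perm)
          (↭-trans (↭-swap _ _ ↭-refl) (↭-prep u (cut-edges pv pe {d = d₁} perm))) (unique-outside u∉)
    ...   | inj₁ h = inj₁ h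
    ...   | inj₂ f = inj₂ λ _ _ _ → f

    -- Double counting the incidences of x and the chord vertices: their degrees sum to at
    -- least (D + 1) δ, while an edge of the cycle meets at most D of them besides x, and an
    -- edge off the cycle at most one.  For D ≥ 1 these bounds have to be attained.
    chorded : (C : Cycle Link) → let open Cycle C in
              ∀ {p} → p ∈ steps → Chord p → Result ⊎ Chorded steps
    chorded C@(cycle {steps = c} w pv pe) {p₀} p₀∈ chord₀
      with find-or-all c (chorded-insertion C)
         | find-or-all c (λ i → find-or-all c (λ j → chorded-crossing C i j))
    ... | inj₁ h | _      = inj₁ h
    ... | inj₂ _ | inj₁ h = inj₁ h
    ... | inj₂ insert | inj₂ cross = inj₂ record
      { complete    = λ i chord y∈ → All.lookup (full y∈) (∈-map⁺ proj₁ (∈-filter⁺ chord? i chord))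
      ; covered     = covered
      ; insert-free = λ i chord u∉ → insert i chord u∉
      ; cross-free  = λ i j chord chord′ ne u∉ → cross i j chord chord′ ne u∉
      ; tight       = tight
      }
      where
      rows : List (X × Fin m)
      rows = filter chord? c
      k D r : ℕ
      k = length vs
      D = length rows
      rest : ∃ λ zs → allFin m ↭ ys ++ zs
      rest = ↭-complement unique λ _ → ∈-allFin _
      zs = proj₁ rest
      r = length zs
      rows⁻ : ∀ {p} → p ∈ rows → p ∈ c × Chord p
      rows⁻ = ∈-filter⁻ chord? {xs = c}
      unique-rows : Unique (map proj₂ rows)
      unique-rows = subst Unique (filter-map (x ~?_) proj₂ c)
        (Unique.filter⁺ (x ~?_) (unique-↭ (↭-sym pe) unique))
      zs∉ : ∀ {u} → u ∈ zs → u ∉ ys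
      zs∉ u∈zs u∈ys = proj₂ (proj₂ (unique-++⁻ ys (unique-↭ (proj₂ rest) (Unique.allFin⁺ m)))) (u∈ys , u∈zs)
      L = x ∷ map proj₁ rows
      -- A cycle edge may meet all D chord vertices, and it meets `x` exactly when it is a chord
      -- edge, so `x` contributes D in total.
      g : Fin m → ℕ
      g y = hits [ x ] y + D
      on-ys : All (λ y → hits L y ≤ g y) ys
      on-ys = All.universal (λ y → ≤-trans (≤-reflexive (hits-∷ x (map proj₁ rows) y))
        (+-monoʳ-≤ (hits [ x ] y) (≤-trans (length-filter (_~? y) (map proj₁ rows))
          (≤-reflexive (length-map proj₁ rows))))) ys
      on-zs : All (λ y → hits L y ≤ 1) zs
      on-zs = All.tabulate λ {u} u∈ → hits≤1
        {y = u} {L} (All.map⁺ (All.tabulate λ i (x~u , z~u) →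
           let j , chord = rows⁻ i in insert j chord (zs∉ u∈) (x~u , z~u)) ∷
         AllPairs.map⁺ (allPairs-of-map proj₂ unique-rows λ i j ne →
           let i′ , chord = rows⁻ i ; j′ , chord′ = rows⁻ j in
           cross i′ j′ chord chord′ ne (zs∉ u∈)))
      total : sum (map g ys) + r ≡ D + k * D + r
      total = cong (_+ r) (trans (sum-+ (hits [ x ]) (λ _ → D) ys)
        (cong₂ _+_ (trans (sum-hits-[-] x ys) degree-on-ys)
                   (trans (sum-const D ys) (cong (_* D) k≡))))
        where
        degree-on-ys : degreeIn ys x ≡ D
        degree-on-ys = trans (↭-length (filter-↭ (x ~?_) (↭-sym pe)))
          (trans (cong length (filter-map (x ~?_) proj₂ c)) (length-map proj₂ rows))
      upper : suc (k + r) ≤ 2 * δ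
      upper = subst (λ i → suc (i + r) ≤ 2 * δ) k≡ (length-complement ys (proj₂ rest))
      rows-pos : ∃ λ e → D ≡ suc e
      rows-pos with rows in eq
      ... | _ ∷ rs = length rs , refl
      ... | [] = contradiction (subst (p₀ ∈_) eq (∈-filter⁺ chord? p₀∈ chord₀)) λ ()
      |L| : length L ≡ suc D
      |L| = cong suc (length-map proj₁ rows)
      -- With D = e + 1, one of the D summands k + 1 joins r to give k + r + 1 ≤ 2δ, and each of the
      -- other e is at most δ.
      enough : sum (map g ys) + r ≤ length L * δ
      enough with rows-pos
      ... | e , D≡ = begin
        sum (map g ys) + r          ≡⟨ total ⟩
        D + k * D + r               ≡⟨ cong (λ d → d + k * d + r) D≡ ⟩
        suc e + k * suc e + r       ≡⟨ solve 3 (λ e k r → (con 1 :+ e) :+ k :* (con 1 :+ e) :+ r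
                                                 := (con 1 :+ (k :+ r)) :+ e :* (con 1 :+ k)) refl e k r ⟩
        suc (k + r) + e * suc k     ≤⟨ +-mono-≤ upper (*-monoʳ-≤ e k<δ) ⟩
        2 * δ + e * δ               ≡⟨ *-distribʳ-+ δ 2 e ⟨
        suc (suc e) * δ             ≡⟨ cong (λ d → suc d * δ) D≡ ⟨
        suc D * δ                   ≡⟨ cong (_* δ) |L| ⟨
        length L * δ                ∎
        where
        open ≤-Reasoning
        open +-*-Solver
      both : All (λ y → hits L y ≡ g y) ys × All (λ y → hits L y ≡ 1) zs
      both = degree-tight L (proj₂ rest) on-ys on-zs enough
      full : ∀ {y} → y ∈ ys → All (_~ y) (map proj₁ rows)
      full {y} y∈ = filter-full (_~? y) (map proj₁ rows) (+-cancelˡ-≡ (hits [ x ] y) _ _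
        (trans (sym (hits-∷ x (map proj₁ rows) y)) (trans (All.lookup (proj₁ both) y∈)
          (cong (hits [ x ] y +_) (sym (length-map proj₁ rows))))))
      covered : ∀ {u} → u ∉ ys → x ~ u ⊎ ∃ λ p → p ∈ c × Chord p × proj₁ p ~ u
      covered {u} u∉ with ∈-++⁻ ys (∈-resp-↭ (proj₂ rest) (∈-allFin u))
      ... | inj₁ u∈ = contradiction u∈ u∉
      ... | inj₂ u∈ with hit L (≤-reflexive (sym (All.lookup (proj₂ both) u∈)))
      ...   | _ , here refl , x~u = inj₁ x~u
      ...   | z , there z∈ , z~u with ∈-map⁻ proj₁ z∈
      ...     | p , i , refl = inj₂ (p , proj₁ (rows⁻ i) , proj₂ (rows⁻ i) , z~u)
      tight : ∀ {p q} → p ∈ c → q ∈ c → Chord p → Chord q → proj₂ p ≢ proj₂ q → δ ≡ suc k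
      -- Now D = 2 + e, so 1 + e ≥ 1 summands k + 1 are compared with δ, and cancelling 1 + e gives
      -- δ ≤ k + 1. The term 2δ + k + 1 is added on both sides to avoid subtraction.
      tight {p} {q} i j chord chord′ ne =
        ≤-antisym (*-cancelˡ-≤ (suc e) (+-cancelʳ-≤ (2 * δ + suc k) _ _ bound)) k<δ
        where
        open ≤-Reasoning
        open +-*-Solver
        two : ∃ λ es → rows ↭ (p ∷ q ∷ []) ++ es
        two = ↭-complement (((λ { refl → ne refl }) ∷ []) ∷ [] ∷ [])
          λ { (here refl) → ∈-filter⁺ chord? i chord ; (there (here refl)) → ∈-filter⁺ chord? j chord′ }
        e = length (proj₁ two)
        D≡ : D ≡ 2 + e
        D≡ = ↭-length (proj₂ two)
        bound : suc e * δ + (2 * δ + suc k) ≤ suc e * suc k + (2 * δ + suc k)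
        bound = begin
          suc e * δ + (2 * δ + suc k)
            ≡⟨ solve 3 (λ e d k → (con 1 :+ e) :* d :+ (con 2 :* d :+ (con 1 :+ k))
                               := (con 3 :+ e) :* d :+ (con 1 :+ k)) refl e δ k ⟩
          suc (2 + e) * δ + suc k
            ≡⟨ cong (λ d → suc d * δ + suc k) D≡ ⟨
          suc D * δ + suc k
            ≡⟨ cong (λ l → l * δ + suc k) |L| ⟨
          length L * δ + suc k
            ≤⟨ +-monoˡ-≤ (suc k) (degree-bound′ L (proj₂ rest) on-ys on-zs) ⟩
          sum (map g ys) + r + suc k
            ≡⟨ cong (_+ suc k) (trans total (cong (λ d → d + k * d + r) D≡)) ⟩
          (2 + e) + k * (2 + e) + r + suc k
            ≡⟨ solve 3 (λ e k r → (con 2 :+ e) :+ k :* (con 2 :+ e) :+ r :+ (con 1 :+ k)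
                 := (con 1 :+ e) :* (con 1 :+ k) :+ ((con 1 :+ (k :+ r)) :+ (con 1 :+ k)))
                 refl e k r ⟩
          suc e * suc k + (suc (k + r) + suc k)
            ≤⟨ +-monoʳ-≤ (suc e * suc k) (+-monoˡ-≤ (suc k) upper) ⟩
          suc e * suc k + (2 * δ + suc k)
            ∎

    Complete : X → Set
    Complete z = ∀ {y} → y ∈ ys → z ~ y

    -- Completeness is carried by the steps themselves, so that it survives opening, splitting and
    -- rotating the cycle.
    Saturated : X → Fin m → X → Set
    Saturated z y q = Link z y q × (x ~ y → Complete z × Complete q)

    links : ∀ {a b c} → Walk Saturated a c b → Walk Link a c b
    links w = strengthen w λ _ → proj₁

    -- Running the cycle backwards makes the ends of the chords complete too.
    saturate : Cycle Link → ∀ {y} → y ∈ ys → x ~ y →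
               Result ⊎ ∃ λ (C : Cycle Saturated) → Chorded (Cycle.steps C)
    saturate C@(cycle {a} w pv pe) y∈ x~y with ∈-map⁻ proj₂ (∈-resp-↭ (↭-sym pe) y∈)
    ... | p , i , refl with chorded C i x~y
    ...   | inj₁ h = inj₁ h
    ...   | inj₂ ch with reverseʷ (strengthen {T = λ z y q → Link z y q × (x ~ y → Complete z)} w
                            λ i l → l , λ chord y∈ → Chorded.complete ch i chord y∈)
    ...     | d , v , qv , qe
      -- The walk is closed, so the final vertex added on either side by `reverseʷ` is `a` and
      -- cancels.
      with ↭-trans (drop-∷ (↭-trans (++-comm [ a ] _) (↭-trans qv (++-comm _ [ a ])))) pv | ↭-trans qe pe
    ...       | pv′ | pe′ with ∈-map⁻ proj₂ (∈-resp-↭ (↭-sym pe′) y∈)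
    ...         | p′ , i′ , refl
      with chorded (cycle (strengthen v λ _ ((r , t) , _) → t , r) pv′ pe′) i′ x~y
    ...           | inj₁ h = inj₁ h
    -- The reversed cycle is returned: `ch′` makes the starts of its chords complete, and `f`, from
    -- the first pass, their ends.
    ...           | inj₂ ch′ = inj₂ (cycle (strengthen v λ i ((r , t) , f) →
                      (t , r) , λ chord → (λ y∈ → Chorded.complete ch′ i chord y∈) , f chord) pv′ pe′ , ch′)

    -- For a chord (z , y , q) the end q is joined to every edge of the cycle, so a vertex z′
    -- with successor q′ and edge y′ sharing u with x gives x –y– z … q′ –y′– q … z′ –u– x.
    lonely : (C : Cycle Saturated) → let open Cycle C in Chorded steps →
             ∀ {p₀} → p₀ ∈ steps → Chord p₀ →
             ∀ {p} → p ∈ steps → Result ⊎ (∀ {u} → u ∉ ys → ¬ (x ~ u × proj₁ p ~ u))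
    lonely (cycle w pv pe) ch i chord j with open-at w i
    ... | q , d , ((z~y , _) , complete) , w′ , perm with ∈-resp-↭ perm j
    ...   | here refl = inj₂ (Chorded.insert-free ch i chord)
    ...   | there j′ with split w′ j′
    ...     | d₁ , q′ , d₂ , refl , w₁ , ((_ , q′~y′) , _) , w₂ =
      outside (λ u → (x ~? u) ×-dec (_ ~? u)) λ {u} u∉ (x~u , z′~u) →
        rejoin (rev (ofWalk (links w₂))) (ofWalk (links w₁)) chord z~y q′~y′
          (proj₂ (complete chord) (∈-resp-↭ pe (∈-map⁺ proj₂ j))) z′~u x~u
          (↭-trans (++-comm (map proj₁ d₂ ∷ʳ _) _) (cut-vertices pv pe {d = d₁} perm))
          (↭-trans (solve 5 (λ y y′ u e f → y ⊕ (y′ ⊕ (u ⊕ (f ⊕ e))) ⊜ u ⊕ (y ⊕ (y′ ⊕ (e ⊕ f)))) ↭-refl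
             [ _ ] [ _ ] [ u ] (map proj₂ d₁) (map proj₂ d₂))
            (↭-prep u (cut-edges pv pe {d = d₁} perm)))
          (unique-outside u∉)
      where open ↭-Solver

    -- With every step a chord, `ys` can serve as Y₀. By `alone` and `cross-free` an edge off the
    -- cycle meets at most one vertex, so any such edge at a vertex is private to it.
    spiked : (C : Cycle Saturated) → let open Cycle C in Chorded steps →
             (∀ {p u} → p ∈ steps → u ∉ ys → ¬ (x ~ u × proj₁ p ~ u)) →
             length ys < δ → (∀ {p} → p ∈ steps → Chord p) → Spiked (x ∷ vs)
    spiked (cycle {steps = c} w pv pe) ch alone lt chords = record
      { ys       = ys
      ; size     = cong suc k≡
      ; unique   = unique
      ; complete = complete
      ; spike = λ z∈ → let y , y∉ , z~y = neighbour-outside lt _ in y , y∉ , z~y , own z∈ y∉ z~y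
      }
      where
      step-of : ∀ {z} → z ∈ vs → ∃ λ p → p ∈ c × z ≡ proj₁ p
      step-of z∈ = ∈-map⁻ proj₁ (∈-resp-↭ (↭-sym pv) z∈)
      complete : ∀ {z y} → z ∈ x ∷ vs → y ∈ ys → z ~ y
      complete (here refl) y∈ with ∈-map⁻ proj₂ (∈-resp-↭ (↭-sym pe) y∈)
      ... | _ , i , refl = chords i
      complete (there z∈) y∈ with step-of z∈
      ... | _ , i , refl = Chorded.complete ch i (chords i) y∈
      own : ∀ {z y} → z ∈ x ∷ vs → y ∉ ys → z ~ y → ∀ {z′} → z′ ∈ x ∷ vs → z′ ~ y → z′ ≡ z
      own (here refl) y∉ r (here refl) t = refl
      own (here refl) y∉ r (there j) t with step-of j
      ... | _ , j′ , refl = contradiction (r , t) (alone j′ y∉)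
      own (there i) y∉ r (here refl) t with step-of i
      ... | _ , i′ , refl = contradiction (t , r) (alone i′ y∉)
      own (there i) y∉ r (there j) t with step-of i | step-of j
      ... | p , i′ , refl | q , j′ , refl with proj₂ p Fin.≟ proj₂ q
      ...   | yes e = cong proj₁ (sym (unique-map-injective proj₂ (unique-↭ (↭-sym pe) unique) i′ j′ e))
      ...   | no ne = contradiction (r , t) (Chorded.cross-free ch i′ j′ (chords i′) (chords j′) ne y∉)

    -- The first chord on the walk starts at a complete vertex. Either this is `q`, or the step just
    -- before is a non-chord with complete end.
    boundary : ∀ {q d z p} → Walk Saturated q d z → p ∈ d → Chord p →
               Complete q ⊎ ∃[ p′ ] ∃[ q′ ] ∃[ d₁ ] ∃[ d₂ ]
                 (d ≡ d₁ ++ p′ ∷ d₂ × Walk Saturated q d₁ (proj₁ p′) × ¬ Chord p′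
                  × Saturated (proj₁ p′) (proj₂ p′) q′ × Complete q′ × Walk Saturated q′ d₂ z)
    boundary {q} (_∷_ {y = y} s w) i chord with x ~? y
    ... | yes x~y = inj₁ (proj₁ (proj₂ s x~y))
    ... | no ¬x~y with i
    ...   | here refl = contradiction chord ¬x~y
    ...   | there i′ with boundary w i′ chord
    ...     | inj₁ complete = inj₂ (_ , _ , [] , _ , refl , [] , ¬x~y , s , complete , w)
    ...     | inj₂ (p′ , q′ , d₁ , d₂ , refl , w₁ , n , t , complete , w₂) =
      inj₂ (p′ , q′ , _ ∷ d₁ , d₂ , refl , s ∷ w₁ , n , t , complete , w₂)

    -- The search for a first chord begins right after the given non-chord `p₁`. If a chord follows
    -- at once, `p₁` itself serves; otherwise the cycle is rotated to the non-chord found.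
    nonchord-opening : ∀ {a c p₀ p₁} → Walk Saturated a c a → p₀ ∈ c → Chord p₀ → p₁ ∈ c → ¬ Chord p₁ →
      ∃[ p ] ∃[ q ] ∃[ d ] (¬ Chord p × Saturated (proj₁ p) (proj₂ p) q × Complete q
                            × Walk Saturated q d (proj₁ p) × c ↭ p ∷ d)
    nonchord-opening {p₁ = p₁} w i chord j ¬chord with open-at w j
    ... | q , d , s , w′ , perm with ∈-resp-↭ perm i
    ...   | here refl = contradiction chord ¬chord
    ...   | there i′ with boundary w′ i′ chord
    ...     | inj₁ complete = p₁ , q , d , ¬chord , s , complete , w′ , perm
    ...     | inj₂ (p , q′ , d₁ , d₂ , refl , w₁ , n , t , complete , w₂) =
      p , q′ , d₂ ++ p₁ ∷ d₁ , n , t , complete , w₂ ++ʷ (s ∷ w₁) ,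
      ↭-trans perm (solve 4 (λ p₁ d₁ p d₂ → p₁ ⊕ (d₁ ⊕ (p ⊕ d₂)) ⊜ p ⊕ (d₂ ⊕ (p₁ ⊕ d₁))) ↭-refl
        [ p₁ ] d₁ [ p ] d₂)
      where open ↭-Solver

    -- Both ends of a chord are complete, so its edge can be traded for any y on the cycle.
    relabel : ∀ {a b d p y} → Walk Saturated a d b → p ∈ d → Chord p → y ∈ ys →
              ∃ λ es → Path a b (map proj₁ d ∷ʳ b) es × proj₂ p ∷ es ↭ y ∷ map proj₂ d
    relabel {b = b} {p = p} {y} w i chord y∈ with split w i
    ... | d₁ , _ , d₂ , refl , w₁ , (_ , complete) , w₂
      with link y (ofWalk (links w₁)) (proj₁ (complete chord) y∈) (proj₂ (complete chord) y∈) (ofWalk (links w₂))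
    ...   | path v pv pe = map proj₂ d₁ ++ y ∷ map proj₂ d₂
      , path v (↭-trans pv (↭-reflexive (trans (++-assoc (map proj₁ d₁) _ _)
          (trans (sym (++-assoc (map proj₁ d₁) _ _)) (cong (_∷ʳ b) (sym (map-++ proj₁ d₁ _))))))) pe
      , ↭-trans (solve 4 (λ p y e f → p ⊕ (e ⊕ (y ⊕ f)) ⊜ y ⊕ (e ⊕ (p ⊕ f))) ↭-refl
          [ proj₂ p ] [ y ] (map proj₂ d₁) (map proj₂ d₂))
          (↭-prep y (↭-reflexive (sym (map-++ proj₂ d₁ _))))
      where open ↭-Solver

    -- Open the cycle at a non-chord (z , y , q) with q complete, and let u be an edge off the
    -- cycle at z.  Then u meets a chord vertex z′ with edge y′ and successor q′, and for a
    -- second chord edge y″ the cycle is x –y′– q′ … z –u– z′ … q –y″– x; the step that used y″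
    -- now uses the released y.
    gap-closing : (C : Cycle Saturated) → let open Cycle C in Chorded steps →
                  (∀ {p u} → p ∈ steps → u ∉ ys → ¬ (x ~ u × proj₁ p ~ u)) → length ys < δ →
                  ∀ {p₀ p₁ p₂} → p₀ ∈ steps → Chord p₀ → p₁ ∈ steps → Chord p₁ → proj₂ p₁ ≢ proj₂ p₀ →
                  p₂ ∈ steps → ¬ Chord p₂ → Result
    gap-closing (cycle {steps = c} w pv pe) ch alone lt {p₀} {p₁} i₀ chord₀ i₁ chord₁ ne i₂ ¬chord₂
      with nonchord-opening w i₀ chord₀ i₂ ¬chord₂
    ... | (z , y) , q , d , ¬chord , _ , complete , w′ , perm with neighbour-outside lt z
    ...   | u , u∉ , z~u with Chorded.covered ch u∉
    ...     | inj₁ x~u = contradiction (x~u , z~u) (alone (∈-resp-↭ (↭-sym perm) (here refl)) u∉)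
    ...     | inj₂ (p , i , chord , p~u) with ∈-resp-↭ perm i
    ...       | here refl = contradiction chord ¬chord
    ...       | there i′ with split w′ i′
    ...         | d₁ , _ , d₂ , refl , w₁ , ((_ , t) , _) , w₂ = finish (another (proj₂ p₀ Fin.≟ proj₂ p))
      where
      open ↭-Solver
      es = map proj₂ d₁
      fs = map proj₂ d₂
      y∈ : y ∈ ys
      y∈ = ∈-resp-↭ (open-edges pv pe perm) (here refl)
      vertices = ↭-trans (++-comm (map proj₁ d₂ ∷ʳ z) _) (cut-vertices pv pe {d = d₁} perm)
      edges : ∀ {y′ gs} → y′ ∷ gs ↭ y ∷ (fs ++ es) → proj₂ p ∷ u ∷ y′ ∷ gs ↭ u ∷ ys
      edges e = ↭-trans (↭-swap _ _ (↭-trans e (↭-prep y (++-comm fs es))))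
        (↭-prep u (↭-trans (↭-swap _ _ ↭-refl) (cut-edges pv pe {d = d₁} perm)))
      -- Two chords with different edges are at hand, so at least one of them differs from `p`.
      another : Dec (proj₂ p₀ ≡ proj₂ p) → ∃ λ p′ → p′ ∈ c × Chord p′ × proj₂ p′ ≢ proj₂ p
      another (yes e) = p₁ , i₁ , chord₁ , λ e′ → ne (trans e′ (sym e))
      another (no n)  = p₀ , i₀ , chord₀ , n
      finish : (∃ λ p′ → p′ ∈ c × Chord p′ × proj₂ p′ ≢ proj₂ p) → Result
      -- The edge of `p′` is needed for the last link to `x`, so it is traded for `y` on whichever
      -- of the two arcs contains it.
      finish (p′ , j , chord′ , n) with ∈-resp-↭ perm j
      ... | here refl = contradiction chord′ ¬chord
      ... | there j′ with ∈-++⁻ d₁ j′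
      ...   | inj₂ (here refl) = contradiction refl n
      ...   | inj₁ j″ with relabel w₁ j″ chord′ y∈
      ...     | es′ , P , e = rejoin (ofWalk (links w₂)) (rev P) chord t z~u p~u
        (complete (∈-resp-↭ pe (∈-map⁺ proj₂ j))) chord′ vertices
        (edges (↭-trans (solve 3 (λ y f e → y ⊕ (f ⊕ e) ⊜ f ⊕ (y ⊕ e)) ↭-refl [ proj₂ p′ ] fs es′)
          (↭-trans (++⁺ (↭-refl {x = fs}) e) (shift y fs es)))) (unique-outside u∉)
      finish (p′ , j , chord′ , n) | there j′ | inj₂ (there j″) with relabel w₂ j″ chord′ y∈
      ...     | fs′ , Q , e = rejoin Q (rev (ofWalk (links w₁))) chord t z~u p~u
        (complete (∈-resp-↭ pe (∈-map⁺ proj₂ j))) chord′ vertices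
        (edges (++⁺ e (↭-refl {x = es}))) (unique-outside u∉)

    chord-case : ∀ {v vs′} → vs ≡ v ∷ vs′ → Cycle Link → ∀ {y} → y ∈ ys → x ~ y →
                 Result ⊎ (δ ≡ length (x ∷ vs) × Spiked (x ∷ vs)) ⊎ TwoBlocks (x ∷ vs)
    chord-case refl C y∈ x~y with saturate C y∈ x~y
    ... | inj₁ h = inj₁ h
    ... | inj₂ (C′@(cycle {steps = c} w pv pe) , ch) with ∈-map⁻ proj₂ (∈-resp-↭ (↭-sym pe) y∈)
    ...   | p₀ , i₀ , refl with find-or-all c (lonely C′ ch i₀ x~y)
    ...     | inj₁ h = inj₁ h
    -- D = 1 is tested before D = k: obtaining δ = k + 1 takes two chords, so D = k = 1 counts as
    -- two blocks.
    ...     | inj₂ alone with Any.any? (λ p → chord? p ×-dec ¬? (proj₂ p Fin.≟ proj₂ p₀)) c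
    ...       | no none = inj₂ (inj₂ (separated (proj₂ p₀) common))
      where
      common : ∀ {q y} → q ∈ vs → x ~ y → q ~ y → y ≡ proj₂ p₀
      common {y = y} q∈ x~y q~y with y ∈? ys | y Fin.≟ proj₂ p₀
      ... | _ | yes e = e
      ... | yes y∈ | no ne with ∈-map⁻ proj₂ (∈-resp-↭ (↭-sym pe) y∈)
      ...   | p , i , refl = contradiction (lose i (x~y , ne)) none
      common q∈ x~y q~y | no y∉ | no ne with ∈-map⁻ proj₁ (∈-resp-↭ (↭-sym pv) q∈)
      ...   | p , i , refl = contradiction (x~y , q~y) (alone i y∉)
    ...       | yes found with find found
    ...         | p₁ , i₁ , chord₁ , ne with All.all? chord? c
    ...           | yes chords = inj₂ (inj₁ (Chorded.tight ch i₀ i₁ x~y chord₁ (ne ∘ sym) ,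
                      spiked C′ ch (λ i → alone i) (subst (_< δ) (sym k≡) k<δ) (All.lookup chords)))
    ...           | no ¬chords with find (All.¬All⇒Any¬ chord? c ¬chords)
    ...             | p₂ , i₂ , ¬chord₂ = inj₁ (gap-closing C′ ch (λ i → alone i)
                        (subst (_< δ) (sym k≡) k<δ) i₀ x~y i₁ chord₁ ne i₂ ¬chord₂)

  -- Induction over the list of vertices

  Outcome : List X → Set
  Outcome vs = Ham vs ⊎ (δ ≡ length vs × Spiked vs) ⊎ TwoBlocks vs

  extend : ∀ x v vs → length (v ∷ vs) < δ → Ham (v ∷ vs) → Outcome (x ∷ v ∷ vs)
  extend x v vs lt (ham {steps = c} w pv u) = cases (Any.any? (x ~?_) (map proj₂ c))
    where
    size : length (map proj₂ c) ≡ length (v ∷ vs)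
    size = trans (length-map proj₂ c) (trans (sym (length-map proj₁ c)) (↭-length pv))
    open Extension x {v ∷ vs} lt {map proj₂ c} u size
    cases : Dec (Any.Any (x ~_) (map proj₂ c)) → Outcome (x ∷ v ∷ vs)
    cases (yes found) with find found
    ... | _ , y∈ , x~y = chord-case refl (cycle w pv ↭-refl) y∈ x~y
    cases (no none) with no-chord refl (cycle w pv ↭-refl) (λ y∈ x~y → none (lose y∈ x~y))
    ... | inj₁ h = inj₁ h
    ... | inj₂ b = inj₂ (inj₂ b)

  outcome : ∀ v vs → length (v ∷ vs) ≤ δ → Outcome (v ∷ vs)
  outcome v [] le with common-neighbour v v
  -- A single vertex forms a cycle of length 1 with any edge at it.
  ... | y , r , _ = inj₁ (ham ((r , r) ∷ []) ↭-refl ([] ∷ []))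
  outcome x (v ∷ vs) le with outcome v vs (<⇒≤ le)
  ... | inj₁ h = extend x v vs le h
  ... | inj₂ (inj₁ (δ≡ , _)) = contradiction δ≡ (>⇒≢ le)
  ... | inj₂ (inj₂ b) with blocks-step le b
  ...   | inj₁ h = inj₁ h
  ...   | inj₂ b′ = inj₂ (inj₂ b′)

-- From lists of vertices to hypergraphs

unique-lookup : {A B : Set} (f : A → B) {xs : List A} → Unique (map f xs) →
                ∀ i j → f (lookup xs i) ≡ f (lookup xs j) → i ≡ j
unique-lookup f {_ ∷ _} _ zero zero _ = refl
unique-lookup f {_ ∷ xs} (n ∷ _) zero (suc j) e = contradiction e (All.lookup n (∈-map⁺ f (∈-lookup j)))
unique-lookup f {_ ∷ xs} (n ∷ _) (suc i) zero e = contradiction (sym e) (All.lookup n (∈-map⁺ f (∈-lookup i)))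
unique-lookup f {_ ∷ _} (_ ∷ u) (suc i) (suc j) e = cong suc (unique-lookup f u i j e)

lookup-injective : {A : Set} {xs : List A} → Unique xs → ∀ {i j} → lookup xs i ≡ lookup xs j → i ≡ j
lookup-injective u = unique-lookup (λ x → x) (subst Unique (sym (map-id _)) u) _ _

m<2n⇒m≤pred[n]+n : ∀ {m} n → m < 2 * n → m ≤ pred n + n
m<2n⇒m≤pred[n]+n (suc k) (s≤s le) = ≤-trans le (+-monoʳ-≤ k (≤-reflexive (+-identityʳ (suc k))))

module _ {N m : ℕ} {A : Set} (enum : A ↔ Fin N) {f : A → Fin m} (f-injective : Injective _≡_ _≡_ f)
  (m≤N : m ≤ N) where

  private module enum = Inverse enum

  -- A missed `y` could be added as a further value, giving an injection from N + 1 elements into m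
  -- ≤ N.
  injective⇒surjective : ∀ y → ∃ λ a → f a ≡ y
  injective⇒surjective y with Fin.any? (λ i → f (enum.from i) Fin.≟ y)
  ... | yes (i , e) = enum.from i , e
  ... | no none = contradiction m≤N (<⇒≱ (Fin.injective⇒≤ g-injective))
    where
    g : Fin (suc N) → Fin m
    g zero    = y
    g (suc i) = f (enum.from i)
    g-injective : Injective _≡_ _≡_ g
    g-injective {zero}  {zero}  _ = refl
    g-injective {zero}  {suc j} e = contradiction (j , sym e) none
    g-injective {suc i} {zero}  e = contradiction (i , e) none
    g-injective {suc i} {suc j} e = cong suc
      (trans (sym (enum.strictlyInverseˡ i)) (trans (cong enum.to (f-injective e)) (enum.strictlyInverseˡ j)))

  injective⇒↔ : Fin m ↔ A
  injective⇒↔ = mk↔ₛ′ (proj₁ ∘ injective⇒surjective) f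
    (λ a → f-injective (proj₂ (injective⇒surjective (f a)))) (proj₂ ∘ injective⇒surjective)

module _ {X Y : Set} {S : X → Y → X → Set} where

  step-inner : ∀ {b d z} → Walk S b d z → ∀ i j → toℕ j ≡ suc (toℕ i) →
               S (proj₁ (lookup d i)) (proj₂ (lookup d i)) (proj₁ (lookup d j))
  step-inner (s ∷ (_ ∷ _)) zero    (suc zero) _ = s
  step-inner (_ ∷ w)       (suc i) (suc j)    e = step-inner w i j (suc-injective e)

  step-last : ∀ {b d z} → Walk S b d z → ∀ i → suc (toℕ i) ≡ length d →
              S (proj₁ (lookup d i)) (proj₂ (lookup d i)) z
  step-last (s ∷ [])      zero    _ = s
  step-last (_ ∷ w)       (suc i) e = step-last w i (suc-injective e)

  -- An inner step ends at the vertex listed next. The end of the last step is not listed after it,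
  -- but in a closed walk it is the first listed vertex, to which `next` wraps around.
  step-next : ∀ {a d} → Walk S a d a → ∀ i →
              S (proj₁ (lookup d i)) (proj₂ (lookup d i)) (proj₁ (lookup d (next i)))
  step-next {d = p ∷ d} w@(_ ∷ _) i with m≤n⇒m<n∨m≡n (Fin.toℕ<n i)
  ... | inj₁ lt = step-inner w i (next i) (trans (Fin.toℕ-fromℕ< _) (m<n⇒m%n≡m lt))
  ... | inj₂ eq =
    subst (λ j → S (proj₁ (lookup (p ∷ d) i)) (proj₂ (lookup (p ∷ d) i)) (proj₁ (lookup (p ∷ d) j)))
      (sym next≡zero) (step-last w i eq)
    where
    next≡zero : next i ≡ zero
    next≡zero = Fin.toℕ-injective (trans (Fin.toℕ-fromℕ< _)
      (trans (cong (_% suc (length d)) eq) (n%n≡0 (suc (length d)))))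

module _ {n m : ℕ} (H : Hypergraph n m) where

  private
    _~_ : Fin n → Fin m → Set
    v ~ e = v ∈ₛ edge H e

    _~?_ : ∀ v e → Dec (v ~ e)
    v ~? e = v ∈ₛ? edge H e

  open Counting _~_ _~?_

  ham⇒hamiltonian : Ham (allFin n) → HasHamiltonianBergeCycle H
  ham⇒hamiltonian (ham {steps = c} w pv u) = length c , record
    { vertexAt           = proj₁ ∘ lookup c
    ; edgeAt             = proj₂ ∘ lookup c
    ; vertexAt-injective = unique-lookup proj₁ (unique-↭ (↭-sym pv) (Unique.allFin⁺ n)) _ _
    ; edgeAt-injective   = unique-lookup proj₂ u _ _
    ; v∈e                = λ i → proj₁ (step-next w i)
    ; next-v∈e           = λ i → proj₂ (step-next w i)
    } , λ v → let p , i , e = ∈-map⁻ proj₁ (∈-resp-↭ (↭-sym pv) (∈-allFin v)) in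
              Any.index i , trans (cong proj₁ (sym (lookup-index i))) (sym e)

  -- Recognising `G₁` and `G₂`

  module _ {δ : ℕ} (δ≤degree : MinDegreeAtLeast δ H) (m<2δ : m < 2 * δ) where

    open MinDegree _~_ _~?_ δ≤degree m<2δ

    -- Y is mapped into the hyperedges; counting makes the injection f a bijection.
    iso-from : ∀ {N} {K : Bigraph} → let open Bigraph K in
               (X-iso : Fin n ↔ X) → Y ↔ Fin N → (f : Y → Fin m) → Injective _≡_ _≡_ f → m ≤ N →
               (∀ x y → x ~ f y ⇔ Adj (Inverse.to X-iso x) y) → incidenceGraph H ≅ K
    iso-from {K = K} X-iso enum f inj le adj = record
      { X-iso   = X-iso
      ; Y-iso   = injective⇒↔ enum inj le
      ; Adj-iso = λ x y → let y′ , fy′≡y = injective⇒surjective enum inj le y in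
          subst (λ e → x ~ e ⇔ Bigraph.Adj K (Inverse.to X-iso x) y′) fy′≡y (adj x y′)
      }

    spiked⇒G₁ : δ ≡ n → Spiked (allFin n) → incidenceGraph H ≅ G₁ n
    spiked⇒G₁ refl S = iso-from (↔-id _) (↔-sym Fin.+↔⊎) f f-injective size′ adj
      where
      open Spiked S
      size≡ : pred n ≡ length ys
      size≡ = cong pred (sym (trans size (length-tabulate {n = n} _)))
      own : Fin n → Fin m
      own z = proj₁ (spike (∈-allFin z))
      own∉ : ∀ z → own z ∉ ys
      own∉ z = proj₁ (proj₂ (spike (∈-allFin z)))
      z~own : ∀ z → z ~ own z
      z~own z = proj₁ (proj₂ (proj₂ (spike (∈-allFin z))))
      own-only : ∀ z {z′} → z′ ~ own z → z′ ≡ z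
      own-only z = proj₂ (proj₂ (proj₂ (spike (∈-allFin z)))) (∈-allFin _)
      f : Fin (pred n) ⊎ Fin n → Fin m
      f (inj₁ i) = lookup ys (inject≤ i (≤-reflexive size≡))
      f (inj₂ z) = own z
      f-injective : Injective _≡_ _≡_ f
      f-injective {inj₁ i} {inj₁ j} e = cong inj₁ (Fin.inject≤-injective _ _ i j (lookup-injective unique e))
      f-injective {inj₁ i} {inj₂ z} e = contradiction (subst (_∈ ys) e (∈-lookup _)) (own∉ z)
      f-injective {inj₂ z} {inj₁ i} e = contradiction (subst (_∈ ys) (sym e) (∈-lookup _)) (own∉ z)
      f-injective {inj₂ z} {inj₂ z′} e = cong inj₂ (own-only z′ (subst (z ~_) e (z~own z)))
      -- As δ = n, the bound m < 2δ leaves room for no edges beyond Y₀ and the private neighbours.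
      size′ : m ≤ pred n + n
      size′ = m<2n⇒m≤pred[n]+n n m<2δ
      adj : ∀ x y → x ~ f y ⇔ Bigraph.Adj (G₁ n) x y
      adj x (inj₁ i) = mk⇔ (λ _ → tt) (λ _ → complete (∈-allFin x) (∈-lookup _))
      adj x (inj₂ z) = mk⇔ (own-only z) (λ { refl → z~own z })

    private
      Glued↔Fin : Glued δ ↔ Fin (suc (pred δ + pred δ))
      Glued↔Fin = mk↔ₛ′ to from to-from from-to
        where
        side : Fin (pred δ) ⊎ Fin (pred δ) → Glued δ
        side (inj₁ i) = left i
        side (inj₂ i) = right i
        to : Glued δ → Fin (suc (pred δ + pred δ))
        to shared    = zero
        to (left i)  = suc (Inverse.from Fin.+↔⊎ (inj₁ i))
        to (right i) = suc (Inverse.from (Fin.+↔⊎ {pred δ}) (inj₂ i))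
        from : Fin (suc (pred δ + pred δ)) → Glued δ
        from zero    = shared
        from (suc i) = side (Inverse.to Fin.+↔⊎ i)
        to-side : ∀ j → to (side j) ≡ suc (Inverse.from Fin.+↔⊎ j)
        to-side (inj₁ _) = refl
        to-side (inj₂ _) = refl
        to-from : ∀ i → to (from i) ≡ i
        to-from zero    = refl
        to-from (suc i) = trans (to-side _) (cong suc (Inverse.strictlyInverseʳ (Fin.+↔⊎ {pred δ}) i))
        from-to : ∀ g → from (to g) ≡ g
        from-to shared    = refl
        from-to (left i)  = cong side (Inverse.strictlyInverseˡ (Fin.+↔⊎ {pred δ}) (inj₁ i))
        from-to (right i) = cong side (Inverse.strictlyInverseˡ (Fin.+↔⊎ {pred δ}) (inj₂ i))

    -- At least δ - 1 edges at `z` remain without `s`, and δ - 1 of them are selected; `iso-from`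
    -- shows later that nothing is left out.
    other-neighbours : ∀ {z s} → z ~ s →
      ∃ λ (g : Fin (pred δ) → Fin m) → Injective _≡_ _≡_ g × (∀ i → z ~ g i × g i ≢ s)
    other-neighbours {z} {s} z~s with ∈-↭-∷ (∈-filter⁺ (z ~?_) (∈-allFin s) z~s)
    ... | zs , perm with unique-↭ perm (Unique.filter⁺ (z ~?_) (Unique.allFin⁺ m))
    ...   | s∉ ∷ u = (λ i → lookup zs (inject≤ i enough))
      , (λ e → Fin.inject≤-injective _ _ _ _ (lookup-injective u e))
      , λ i → proj₂ (∈-filter⁻ (z ~?_) {xs = allFin m} (∈-resp-↭ (↭-sym perm) (there (∈-lookup _))))
            , λ e → All.lookup s∉ (∈-lookup _) (sym e)
      where
      enough : pred δ ≤ length zs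
      enough = pred-mono-≤ (≤-trans (δ≤degree z) (≤-reflexive (↭-length perm)))

    parts-length : (B : TwoBlocks (allFin n)) → let open TwoBlocks B in
                   suc (length as) + suc (length bs) ≡ n
    parts-length B = sym (trans (sym (length-tabulate _)) (trans (↭-length parts) (length-++ (a ∷ as))))
      where open TwoBlocks B

    -- It suffices to select edges at `a` and at `b`, because the vertices of a block lie on the
    -- same edges. Edges chosen on different sides cannot coincide: they would be `s`.
    blocks⇒G₂ : (B : TwoBlocks (allFin n)) → let open TwoBlocks B in
                incidenceGraph H ≅ G₂ δ (suc (length as)) (suc (length bs))
    blocks⇒G₂ B = iso-from X-iso Glued↔Fin f f-injective
      (≤-trans (m<2n⇒m≤pred[n]+n δ m<2δ) (pred[n]+n≤ δ)) λ x y → adj (Inverse.to X-iso x) y (X-iso-lookup x)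
      where
      open TwoBlocks B
      -- Only an inequality, since for δ = 0 the type `Glued δ` still has the element `shared`.
      pred[n]+n≤ : ∀ n → pred n + n ≤ suc (pred n + pred n)
      pred[n]+n≤ zero    = z≤n
      pred[n]+n≤ (suc k) = ≤-reflexive (+-suc k k)
      Part = Fin (suc (length as)) ⊎ Fin (suc (length bs))
      vertex : Part → Fin n
      vertex (inj₁ i) = lookup (a ∷ as) i
      vertex (inj₂ i) = lookup (b ∷ bs) i
      uniques = unique-++⁻ (a ∷ as) (unique-↭ parts (Unique.allFin⁺ n))
      vertex-injective : Injective _≡_ _≡_ vertex
      vertex-injective {inj₁ i} {inj₁ j} e = cong inj₁ (lookup-injective (proj₁ uniques) e)
      vertex-injective {inj₂ i} {inj₂ j} e = cong inj₂ (lookup-injective (proj₁ (proj₂ uniques)) e)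
      vertex-injective {inj₁ i} {inj₂ j} e =
        contradiction (∈-lookup i , subst (_∈ b ∷ bs) (sym e) (∈-lookup j)) (proj₂ (proj₂ uniques))
      vertex-injective {inj₂ i} {inj₁ j} e =
        contradiction (∈-lookup j , subst (_∈ b ∷ bs) e (∈-lookup i)) (proj₂ (proj₂ uniques))
      enum : Part ↔ Fin (suc (length as) + suc (length bs))
      enum = ↔-sym Fin.+↔⊎
      n≤ : n ≤ suc (length as) + suc (length bs)
      n≤ = ≤-reflexive (sym (parts-length B))
      X-iso : Fin n ↔ Part
      X-iso = injective⇒↔ enum vertex-injective n≤
      X-iso-lookup : ∀ x → vertex (Inverse.to X-iso x) ≡ x
      X-iso-lookup = Inverse.strictlyInverseʳ X-iso
      lefts  = other-neighbours (block-common B (here refl))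
      rights = other-neighbours (block-common (flip B) (here refl))
      f : Glued δ → Fin m
      f shared    = s
      f (left i)  = proj₁ lefts i
      f (right i) = proj₁ rights i
      a~left : ∀ i → a ~ f (left i)
      a~left i = proj₁ (proj₂ (proj₂ lefts) i)
      b~right : ∀ i → b ~ f (right i)
      b~right i = proj₁ (proj₂ (proj₂ rights) i)
      left≢s : ∀ i → f (left i) ≢ s
      left≢s i = proj₂ (proj₂ (proj₂ lefts) i)
      right≢s : ∀ i → f (right i) ≢ s
      right≢s i = proj₂ (proj₂ (proj₂ rights) i)
      f-injective : Injective _≡_ _≡_ f
      f-injective {shared}  {shared}  _ = refl
      f-injective {shared}  {left j}  e = contradiction (sym e) (left≢s j)
      f-injective {shared}  {right j} e = contradiction (sym e) (right≢s j)
      f-injective {left i}  {shared}  e = contradiction e (left≢s i)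
      f-injective {left i}  {left j}  e = cong left (proj₁ (proj₂ lefts) e)
      f-injective {left i}  {right j} e = contradiction
        (TwoBlocks.common B (here refl) (here refl) (a~left i) (subst (b ~_) (sym e) (b~right j))) (left≢s i)
      f-injective {right i} {shared}  e = contradiction e (right≢s i)
      f-injective {right i} {left j}  e = contradiction
        (TwoBlocks.common B (here refl) (here refl) (a~left j) (subst (b ~_) e (b~right i))) (left≢s j)
      f-injective {right i} {right j} e = cong right (proj₁ (proj₂ rights) e)
      adj : ∀ {x} v y → vertex v ≡ x → x ~ f y ⇔ Bigraph.Adj (G₂ δ (suc (length as)) (suc (length bs))) v y
      adj (inj₁ i) shared refl = mk⇔ (λ _ → tt) (λ _ → block-common B (∈-lookup i))
      adj (inj₂ i) shared refl = mk⇔ (λ _ → tt) (λ _ → block-common (flip B) (∈-lookup i))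
      adj (inj₁ i) (left j) refl = mk⇔ (λ _ → tt) (λ _ → block-alike B (here refl) (∈-lookup i) (a~left j))
      adj (inj₂ i) (right j) refl = mk⇔ (λ _ → tt) (λ _ → block-alike (flip B) (here refl) (∈-lookup i) (b~right j))
      adj (inj₁ i) (right j) refl = mk⇔
        (λ r → right≢s j (TwoBlocks.common B (∈-lookup i) (here refl) r (b~right j))) λ ()
      adj (inj₂ i) (left j) refl = mk⇔
        (λ r → left≢s j (TwoBlocks.common B (here refl) (∈-lookup i) (a~left j) r)) λ ()

    blocks⇒ordered-G₂ : TwoBlocks (allFin n) →
                        ∃[ a ] ∃[ b ] (0 < b × a ≥ b × a + b ≡ n × incidenceGraph H ≅ G₂ δ a b)
    blocks⇒ordered-G₂ B with ≤-total (length (TwoBlocks.bs B)) (length (TwoBlocks.as B))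
    ... | inj₁ le = _ , _ , s≤s z≤n , s≤s le , parts-length B , blocks⇒G₂ B
    ... | inj₂ le = _ , _ , s≤s z≤n , s≤s le , parts-length (flip B) , blocks⇒G₂ (flip B)

    classify : n ≢ 0 → n ≤ δ → HasHamiltonianBergeCycle H ⊎ (δ ≡ n × incidenceGraph H ≅ G₁ n)
      ⊎ (∃[ a ] ∃[ b ] (0 < b × a ≥ b × a + b ≡ n × incidenceGraph H ≅ G₂ δ a b))
    classify n≢0 n≤δ with outcome′ (allFin n) (length-tabulate _)
      where
      outcome′ : ∀ vs → length vs ≡ n → Outcome vs
      outcome′ [] e = contradiction (sym e) n≢0
      outcome′ (v ∷ vs) e = outcome v vs (≤-trans (≤-reflexive e) n≤δ)
    ... | inj₁ h = inj₁ (ham⇒hamiltonian h)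
    ... | inj₂ (inj₁ (δ≡ , S)) =
      let δ≡n = trans δ≡ (length-tabulate _) in inj₂ (inj₁ (δ≡n , spiked⇒G₁ δ≡n S))
    ... | inj₂ (inj₂ B) = inj₂ (inj₂ (blocks⇒ordered-G₂ B))

theorem5 : (n m δ : ℕ) → δ ≥ n → 2 * δ ≥ m + 1 →
    (H : Hypergraph n m) → MinDegreeAtLeast δ H →
    ¬ HasHamiltonianBergeCycle H →
    (δ ≡ n × incidenceGraph H ≅ G₁ n)
    ⊎ (∃[ a ] ∃[ b ] (0 < b × a ≥ b × a + b ≡ n × incidenceGraph H ≅ G₂ δ a b))
-- Without vertices the empty cycle is hamiltonian; the induction over vertices starts from one
-- vertex.
theorem5 zero m δ _ _ H _ none = contradiction
  (0 , record { vertexAt = λ () ; edgeAt = λ () ; vertexAt-injective = λ { {()} }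
              ; edgeAt-injective = λ { {()} } ; v∈e = λ () ; next-v∈e = λ () } , λ ()) none
theorem5 (suc _) m δ δ≥n 2δ≥m+1 H δ≤degree none
  with classify H δ≤degree (≤-trans (≤-reflexive (+-comm 1 m)) 2δ≥m+1) (λ ()) δ≥n
... | inj₁ h = contradiction h none
... | inj₂ r = r
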